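{- Let $G$ be a $2$-tree-connected graph of order at least two. If for all $S\subseteq V(G)$, $$\omega(G\setminus S)\le\frac27|S|+\frac97,$$ then $G$ admits a connected $\{2,4\}$-factor.
   Context: All graphs are finite, without loops, multiple edges allowed. A graph is $2$-tree-connected if it has $2$ edge-disjoint spanning trees. $\omega$ counts components; $G\setminus S$ deletes the vertices of $S$. A $\{2,4\}$-factor is a spanning subgraph all of whose degrees are $2$ or $4$. -}

module Defs where

open import Data.Nat using (ℕ; zero; suc; _+_; _*_; _≤_)
open import Data.Fin using (Fin; _≟_)
open import Data.Fin.Subset using (Subset; _∈_; _∉_; ∣_∣; _∩_)
open import Data.Vec using (tabulate)
open import Data.Bool using (Bool; true; false; _∨_)
open import Data.Product using (Σ; _×_; _,_; proj₁; proj₂)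
open import Data.Sum using (_⊎_)
open import Relation.Nullary using (¬_)
open import Relation.Nullary.Decidable using (⌊_⌋)
open import Relation.Binary.PropositionalEquality using (_≡_; _≢_)
open import Function using (Injective; Surjective)

-- A finite multigraph without loops: vertices Fin n, edges Fin m,
-- each edge has two distinct endpoints; parallel edges allowed.
record Graph : Set where
  field
    n      : ℕ
    m      : ℕ
    ends   : Fin m → Fin n × Fin n
    noLoop : ∀ e → proj₁ (ends e) ≢ proj₂ (ends e)
open Graph public

Vertex : Graph → Set
Vertex G = Fin (n G)

Edge : Graph → Set
Edge G = Fin (m G)

-- edge sets (spanning subgraphs) and vertex sets
EdgeSet : Graph → Set
EdgeSet G = Subset (m G)

VertexSet : Graph → Set
VertexSet G = Subset (n G)

Joins : (G : Graph) → Edge G → Vertex G → Vertex G → Set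
Joins G e u v =
  (proj₁ (ends G e) ≡ u × proj₂ (ends G e) ≡ v) ⊎ (proj₁ (ends G e) ≡ v × proj₂ (ends G e) ≡ u)

data Reach (G : Graph) (F : EdgeSet G) : Vertex G → Vertex G → Set where
  here : ∀ {u} → Reach G F u u
  step : ∀ {u w v} (e : Edge G) → e ∈ F → Joins G e u w → Reach G F w v → Reach G F u v

Connected : (G : Graph) → EdgeSet G → Set
Connected G F = ∀ u v → Reach G F u v

next : ∀ {k} → Fin (suc k) → Fin (suc k)
next {k} i = Data.Fin.fromℕ< (Data.Nat.DivMod.m%n<n (suc (Data.Fin.toℕ i)) (suc k))
  where import Data.Nat.DivMod
        import Data.Fin

record Cycle (G : Graph) (F : EdgeSet G) : Set where
  field
    k     : ℕ
    es    : Fin (suc k) → Edge G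
    vs    : Fin (suc k) → Vertex G
    esInj : Injective _≡_ _≡_ es
    vsInj : Injective _≡_ _≡_ vs
    inF   : ∀ i → es i ∈ F
    joins : ∀ i → Joins G (es i) (vs i) (vs (next i))

Acyclic : (G : Graph) → EdgeSet G → Set
Acyclic G F = ¬ Cycle G F

SpanningTree : (G : Graph) → EdgeSet G → Set
SpanningTree G F = Connected G F × Acyclic G F

TwoTreeConnected : Graph → Set
TwoTreeConnected G =
  Σ (EdgeSet G) λ T₁ → Σ (EdgeSet G) λ T₂ →
    SpanningTree G T₁ × SpanningTree G T₂ × (∀ e → e ∈ T₁ → e ∉ T₂)

incident : (G : Graph) → Vertex G → EdgeSet G
incident G v = tabulate λ e → ⌊ proj₁ (ends G e) ≟ v ⌋ ∨ ⌊ proj₂ (ends G e) ≟ v ⌋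

degree : (G : Graph) → EdgeSet G → Vertex G → ℕ
degree G F v = ∣ F ∩ incident G v ∣

Is24Factor : (G : Graph) → EdgeSet G → Set
Is24Factor G F = ∀ v → degree G F v ≡ 2 ⊎ degree G F v ≡ 4

edgesAvoiding : (G : Graph) → VertexSet G → EdgeSet G
edgesAvoiding G S = tabulate λ e →
  Data.Bool.not (⌊ proj₁ (ends G e) Data.Fin.Subset.Properties.∈? S ⌋
                 ∨ ⌊ proj₂ (ends G e) Data.Fin.Subset.Properties.∈? S ⌋)
  where import Data.Bool
        import Data.Fin.Subset.Properties

Remaining : (G : Graph) → VertexSet G → Set
Remaining G S = Σ (Vertex G) λ v → v ∉ S

-- ω(G \ S) = c : the components of G \ S are in bijection-compatible
-- correspondence with Fin c (labelling surjective, same label ⇔ same component)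
NumComponents : (G : Graph) → VertexSet G → ℕ → Set
NumComponents G S c =
  Σ (Remaining G S → Fin c) λ f →
    Surjective _≡_ _≡_ f ×
    (∀ u v → (f u ≡ f v → Reach G (edgesAvoiding G S) (proj₁ u) (proj₁ v))
           × (Reach G (edgesAvoiding G S) (proj₁ u) (proj₁ v) → f u ≡ f v))

{-# OPTIONS --safe #-}
-- Two disjoint spanning trees whose union has maximum degree at most 5 suffice: one tree together with the subset of
-- the other that corrects its parities is connected and even, with degrees 2 or 4.
-- Choose two disjoint spanning trees, with union b, of minimum total excess of the degrees over 5.  If some vertex u has
-- degree at least 6 in b, edge exchanges yield a set S ∋ u of vertices of degree at least 5 in b such that every edge of
-- G ∖ S between different classes lies in b, where the classes are the maximal vertex sets of b ∖ S spanned by both trees.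
-- With p classes and e edges between them, counting the edges of b gives |S| + 5 + e ≤ 2p.  On the other hand, deleting
-- suitable vertices one at a time shows that every graph with p vertices and e edges (or p classes and e edges between
-- them) has a set X whose removal leaves k components with 4p − 2e ≤ 7k − 2|X|.  Together, 7k ≥ 2|S ∪ X| + 10.
module Submission where

open import Defs
open import Data.Nat using (ℕ; zero; suc; _+_; _*_; _∸_; _≤_; _<_; _≤?_; _<?_; z≤n; s≤s)
import Data.Nat as Nat
open import Data.Nat.Induction using (<-wellFounded)
open import Data.Nat.Properties hiding (_≟_; suc-injective; _≤?_; _<?_)
open import Data.Nat.Tactic.RingSolver using (solve-∀)
open import Data.Fin using (Fin; zero; suc; toℕ; _≟_)
open import Data.Fin.Properties using (any?; all?; suc-injective; toℕ-injective; injective⇒≤)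
open import Data.Fin.Subset using (Subset; ∣_∣; _∩_) renaming (_∈_ to _∈ˢ_; _∉_ to _∉ˢ_)
open import Data.Fin.Subset.Properties using (anySubset?; _∈?_)
open import Data.Vec using ([]; _∷_; lookup; tabulate)
open import Data.Vec.Properties using (lookup∘tabulate; lookup⇒[]=; []=⇒lookup; lookup-zipWith)
open import Data.Bool using (Bool; true; false; _∧_; _∨_; _xor_; not; if_then_else_)
import Data.Bool as Bool
open import Data.Bool.Properties
  using (xor-∧-commutativeRing; xor-same; xor-identityʳ; xor-comm; ∧-distribʳ-xor; ∧-distribˡ-xor; ∧-zeroʳ; ∧-identityʳ; ∧-comm)
open import Data.Maybe using (Maybe; just; nothing; is-just)
open import Data.Product using (Σ; ∃; _×_; _,_; proj₁; proj₂)
open import Data.Sum using (_⊎_; inj₁; inj₂)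
import Data.Sum as Sum
open import Data.Unit using (⊤; tt)
open import Data.Empty using (⊥; ⊥-elim)
open import Data.List using (List; []; _∷_; allFin)
open import Data.List.Membership.Propositional using () renaming (_∈_ to _∈ₗ_)
open import Data.List.Membership.Propositional.Properties using (∈-allFin)
open import Data.List.Relation.Unary.Any using (here; there)
open import Function using (_∘_; Surjective)
open import Induction.WellFounded using (Acc; acc)
open import Relation.Nullary using (¬_; Dec; yes; no; does; ¬?; _×-dec_; _⊎-dec_; _→-dec_)
open import Relation.Nullary.Decidable using (dec-true; dec-false; decidable-stable; isYes≗does) renaming (map′ to dec-map)
open import Relation.Binary.Structures using (IsEquivalence)
open import Relation.Binary.PropositionalEquality
  using (_≡_; _≢_; refl; sym; trans; cong; cong₂; subst; subst₂; module ≡-Reasoning)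
open import Algebra.Bundles using (CommutativeRing)
open import Algebra.Properties.CommutativeMonoid.Sum +-0-commutativeMonoid
  using (sum; sum-cong-≗; ∑-distrib-+; ∑-comm)
open import Algebra.Properties.CommutativeMonoid.Sum (CommutativeRing.+-commutativeMonoid xor-∧-commutativeRing)
  using () renaming (sum to ⊕; sum-cong-≗ to ⊕-cong; ∑-distrib-+ to ⊕-xor; ∑-comm to ⊕-comm)
open import Algebra.Properties.Semiring.Sum +-*-semiring using (*-distribˡ-sum)

-- The exchange is matroid union for two graphic matroids: an uncoloured edge `g` closes a circuit
-- with the two trees, and any edge of that circuit can be swapped out for `g`. If no circuit edge
-- meets a vertex `z`, the vertices of the circuit are spanned by both trees without `z`. Swapping
-- `g` in raises the degrees of its ends, so it is harmless only when both have degree at most 4.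
-- The obstacle is that a vertex of degree 5 may have degree 4 in another optimal pair of trees.
-- Hence all optimal rearrangements of `b` inside the classes are considered at once: starting from
-- `u`, the set `S` absorbs the vertices that have degree at least 5 in every one of them, and
-- rearrangements in different classes can be combined. The 5-cycle dictates the factor 7: it gives
-- equality in 4p - 2e ≤ 7k - 2|X|, with |X| = k = 2. The 5 in |S| + 5 + e ≤ 2p is 4, as the trees
-- have two edges fewer than 2n and each edge counts twice, plus 1 from the degree of `u`; doubled,
-- it just beats the 9 of the hypothesis. Whether a factor exists is decidable, so all choices may
-- be made by excluded middle under a double negation.

does⇒ : ∀ {a} {A : Set a} (d : Dec A) → does d ≡ true → A
does⇒ (yes a) _ = a

¬true⇒false : ∀ {b} → ¬ (b ≡ true) → b ≡ false
¬true⇒false {false} _ = refl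
¬true⇒false {true}  h = ⊥-elim (h refl)

true≢false : ∀ {b} → b ≡ true → b ≡ false → ⊥
true≢false refl ()

∧-true : ∀ {a b} → a ∧ b ≡ true → (a ≡ true) × (b ≡ true)
∧-true {true} {true} _ = refl , refl

true-∧ : ∀ {a b} → a ≡ true → b ≡ true → a ∧ b ≡ true
true-∧ refl refl = refl

∨-true : ∀ {a b} → a ∨ b ≡ true → (a ≡ true) ⊎ (b ≡ true)
∨-true {true}  _ = inj₁ refl
∨-true {false} h = inj₂ h

∨-trueʳ : ∀ {a b} → b ≡ true → a ∨ b ≡ true
∨-trueʳ {false} h = h
∨-trueʳ {true}  _ = refl

∨-trueˡ : ∀ {a b} → a ≡ true → a ∨ b ≡ true
∨-trueˡ refl = refl

not-true : ∀ {a} → not a ≡ true → a ≡ false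
not-true {false} _ = refl

true-not : ∀ {a} → a ≡ false → not a ≡ true
true-not refl = refl

-- Linear inequalities are obtained by adding up hypotheses and letting the ring solver match both sides up to K.
cancel : ∀ K {l r L R} → l + K ≡ L → r + K ≡ R → L ≤ R → l ≤ r
cancel K {l} {r} refl refl h = +-cancelʳ-≤ K l r h

-- Finite sums and cardinalities

sum-mono : ∀ {n} {f g : Fin n → ℕ} → (∀ i → f i ≤ g i) → sum f ≤ sum g
sum-mono {zero}  h = z≤n
sum-mono {suc n} h = +-mono-≤ (h zero) (sum-mono (h ∘ suc))

sum-mono-< : ∀ {n} {f g : Fin n → ℕ} → (∀ i → f i ≤ g i) → (j : Fin n) → f j < g j → sum f < sum g
sum-mono-< h zero    l = +-mono-<-≤ l (sum-mono (h ∘ suc))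
sum-mono-< h (suc j) l = +-mono-≤-< (h zero) (sum-mono-< (h ∘ suc) j l)

term≤sum : ∀ {n} (f : Fin n → ℕ) i → f i ≤ sum f
term≤sum f zero    = m≤m+n _ _
term≤sum f (suc i) = ≤-trans (term≤sum (f ∘ suc) i) (m≤n+m _ _)

sum-zero : ∀ {n} {f : Fin n → ℕ} → (∀ i → f i ≡ 0) → sum f ≡ 0
sum-zero {zero}  h = refl
sum-zero {suc n} h = cong₂ _+_ (h zero) (sum-zero (h ∘ suc))

⟦_⟧ : Bool → ℕ
⟦ true  ⟧ = 1
⟦ false ⟧ = 0

∧-* : ∀ a b → ⟦ a ∧ b ⟧ ≡ ⟦ a ⟧ * ⟦ b ⟧
∧-* true  b = sym (+-identityʳ ⟦ b ⟧)
∧-* false b = refl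

⟦⟧-mono : ∀ {a b} → (a ≡ true → b ≡ true) → ⟦ a ⟧ ≤ ⟦ b ⟧
⟦⟧-mono {false}         h = z≤n
⟦⟧-mono {true} {true}   h = ≤-refl
⟦⟧-mono {true} {false}  h with () ← h refl

infix 8 #_

infix 9 _==_

_==_ : ∀ {n} → Fin n → Fin n → Bool
i == j = does (i ≟ j)

==-refl : ∀ {n} (i : Fin n) → i == i ≡ true
==-refl i = dec-true (i ≟ i) refl

==⇒≡ : ∀ {n} {i j : Fin n} → i == j ≡ true → i ≡ j
==⇒≡ {i = i} {j} = does⇒ (i ≟ j)

≢⇒== : ∀ {n} {i j : Fin n} → i ≢ j → i == j ≡ false
≢⇒== {i = i} {j} = dec-false (i ≟ j)

==-sym : ∀ {n} (i j : Fin n) → i == j ≡ j == i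
==-sym i j with i ≟ j
... | yes refl = sym (==-refl i)
... | no  i≢j  = sym (≢⇒== (i≢j ∘ sym))

infixl 7 _─_ _⊞_

_─_ : ∀ {n} → (Fin n → Bool) → Fin n → Fin n → Bool
(f ─ x) i = f i ∧ not (i == x)

_⊞_ : ∀ {n} → (Fin n → Bool) → Fin n → Fin n → Bool
(f ⊞ x) i = f i ∨ i == x

─-self : ∀ {n} (f : Fin n → Bool) x → (f ─ x) x ≡ false
─-self f x rewrite ==-refl x with f x
... | true  = refl
... | false = refl

─-other : ∀ {n} (f : Fin n → Bool) {x i} → i ≢ x → (f ─ x) i ≡ f i
─-other f {x} {i} i≢x rewrite ≢⇒== i≢x with f i
... | true  = refl
... | false = refl

⊞-self : ∀ {n} (f : Fin n → Bool) x → (f ⊞ x) x ≡ true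
⊞-self f x = ∨-trueʳ {f x} (==-refl x)

⊞-other : ∀ {n} (f : Fin n → Bool) {x i} → i ≢ x → (f ⊞ x) i ≡ f i
⊞-other f {x} {i} i≢x rewrite ≢⇒== i≢x with f i
... | true  = refl
... | false = refl

─⁻ : ∀ {n} (f : Fin n → Bool) {x i} → (f ─ x) i ≡ true → f i ≡ true × i ≢ x
─⁻ f {x} {i} h with i ≟ x
... | yes refl with () ← proj₂ (∧-true {f i} h)
─⁻ f {x} {i} h | no i≢x = proj₁ (∧-true h) , i≢x

opaque

  -- Opaque, so that cardinalities stay atoms for unification, `rewrite` and the ring solver.
  #_ : ∀ {n} → (Fin n → Bool) → ℕ
  # f = sum (λ i → ⟦ f i ⟧)

  #≡sum : ∀ {n} (f : Fin n → Bool) → # f ≡ sum (λ i → ⟦ f i ⟧)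
  #≡sum f = refl

  #-cong : ∀ {n} {f g : Fin n → Bool} → (∀ i → f i ≡ g i) → # f ≡ # g
  #-cong h = sum-cong-≗ (λ i → cong ⟦_⟧ (h i))

  #-mono : ∀ {n} {f g : Fin n → Bool} → (∀ i → f i ≡ true → g i ≡ true) → # f ≤ # g
  #-mono h = sum-mono (λ i → ⟦⟧-mono (h i))

  #-mono-< : ∀ {n} {f g : Fin n → Bool} → (∀ i → f i ≡ true → g i ≡ true) →
             ∀ j → f j ≡ false → g j ≡ true → # f < # g
  #-mono-< {f = f} {g} h j fj gj = sum-mono-< (λ i → ⟦⟧-mono (h i)) j lt
    where
    lt : ⟦ f j ⟧ < ⟦ g j ⟧
    lt rewrite fj | gj = ≤-refl

  #-+ : ∀ {n} {f g h k : Fin n → Bool} → (∀ i → ⟦ f i ⟧ + ⟦ g i ⟧ ≡ ⟦ h i ⟧ + ⟦ k i ⟧) →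
        # f + # g ≡ # h + # k
  #-+ {f = f} {g} {h} {k} eq =
    trans (sym (∑-distrib-+ (⟦_⟧ ∘ f) (⟦_⟧ ∘ g)))
          (trans (sum-cong-≗ eq) (∑-distrib-+ (⟦_⟧ ∘ h) (⟦_⟧ ∘ k)))

  #-split : ∀ {n} {f g h : Fin n → Bool} → (∀ i → ⟦ f i ⟧ ≡ ⟦ g i ⟧ + ⟦ h i ⟧) → # f ≡ # g + # h
  #-split {f = f} {g} {h} eq = trans (sum-cong-≗ eq) (∑-distrib-+ (⟦_⟧ ∘ g) (⟦_⟧ ∘ h))

  #-≤+ : ∀ {n} {f g h : Fin n → Bool} → (∀ i → ⟦ f i ⟧ ≤ ⟦ g i ⟧ + ⟦ h i ⟧) → # f ≤ # g + # h
  #-≤+ {f = f} {g} {h} le = ≤-trans (sum-mono le) (≤-reflexive (∑-distrib-+ (⟦_⟧ ∘ g) (⟦_⟧ ∘ h)))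

  #-none : ∀ {n} {f : Fin n → Bool} → (∀ i → f i ≡ false) → # f ≡ 0
  #-none h = sum-zero (λ i → cong ⟦_⟧ (h i))

  #-all : ∀ n → # (λ (_ : Fin n) → true) ≡ n
  #-all zero    = refl
  #-all (suc n) = cong suc (#-all n)

  #-pos : ∀ {n} {f : Fin n → Bool} i → f i ≡ true → 1 ≤ # f
  #-pos {f = f} i fi = ≤-trans (≤-reflexive (cong ⟦_⟧ (sym fi))) (term≤sum (⟦_⟧ ∘ f) i)

  #-witness : ∀ {n} {f : Fin n → Bool} → 1 ≤ # f → ∃ λ i → f i ≡ true
  #-witness {f = f} h with any? (λ i → f i Bool.≟ true)
  ... | yes w = w
  ... | no ¬w with () ← subst (1 ≤_) (#-none {f = f} (λ i → ¬true⇒false (λ p → ¬w (i , p)))) h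

  #-single : ∀ {n} (x : Fin n) → # (λ i → i == x) ≡ 1
  #-single {suc n} zero = cong suc (#-none {n} {λ i → suc i == zero} (λ i → refl))
  #-single (suc x)      = #-single x

  #-single′ : ∀ {n} (x : Fin n) → # (λ i → x == i) ≡ 1
  #-single′ x = trans (#-cong (==-sym x)) (#-single x)

  #-─ : ∀ {n} (f : Fin n → Bool) {x} → f x ≡ true → # f ≡ suc (# (f ─ x))
  #-─ f {x} fx = trans (#-split {f = f} {g = λ i → i == x} {h = f ─ x} pt) (cong (_+ # (f ─ x)) (#-single x))
    where
    pt : ∀ i → ⟦ f i ⟧ ≡ ⟦ i == x ⟧ + ⟦ (f ─ x) i ⟧
    pt i with i ≟ x
    ... | yes refl rewrite fx = refl
    ... | no _ with f i
    ...   | true  = refl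
    ...   | false = refl

  #-⊞ : ∀ {n} (f : Fin n → Bool) {x} → f x ≡ false → # (f ⊞ x) ≡ suc (# f)
  #-⊞ f {x} fx = trans (#-split {f = f ⊞ x} {g = λ i → i == x} {h = f} pt) (cong (_+ # f) (#-single x))
    where
    pt : ∀ i → ⟦ (f ⊞ x) i ⟧ ≡ ⟦ i == x ⟧ + ⟦ f i ⟧
    pt i with i ≟ x
    ... | yes refl rewrite fx = refl
    ... | no _ with f i
    ...   | true  = refl
    ...   | false = refl

  #-two : ∀ {n} (f g : Fin n → Bool) → (∀ i → g i ≡ true → f i ≡ true) →
          ∀ {i j} → i ≢ j → f i ≡ true → f j ≡ true → g i ≡ false → g j ≡ false → 2 + # g ≤ # f
  #-two f g g⊆f {i} {j} i≢j fi fj gi gj = ≤-trans (s≤s (#-mono-< sub j gj (trans (─-other f (i≢j ∘ sym)) fj)))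
                                                  (≤-reflexive (sym (#-─ f fi)))
    where
    sub : ∀ l → g l ≡ true → (f ─ i) l ≡ true
    sub l gl = trans (─-other f l≢i) (g⊆f l gl)
      where
      l≢i : l ≢ i
      l≢i refl = true≢false gl gi

  #-comm : ∀ {m n} (g : Fin m → Fin n → Bool) → sum (λ v → # (g v)) ≡ sum (λ e → # (λ v → g v e))
  #-comm g = ∑-comm (λ v e → ⟦ g v e ⟧)

  sum-# : ∀ {n} (f g : Fin n → Bool) → sum (λ i → ⟦ f i ⟧ + ⟦ g i ⟧) ≡ # f + # g
  sum-# f g = ∑-distrib-+ (λ i → ⟦ f i ⟧) (λ i → ⟦ g i ⟧)

  sum-*# : ∀ {n} k (f : Fin n → Bool) → sum (λ i → k * ⟦ f i ⟧) ≡ k * # f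
  sum-*# k f = sym (*-distribˡ-sum k (λ i → ⟦ f i ⟧))

  #-image : ∀ {m n} (D : Fin m → Bool) (h : Fin m → Fin n) (I : Fin n → Bool) →
            (∀ v → I v ≡ true → ∃ λ e → D e ≡ true × h e ≡ v) → # I ≤ # D
  #-image {n = n} D h I sur = begin
    -- Double counting of the pairs (e, v) with `D e` and `h e` equal to `v`: every `v` in `I`
    -- occurs at least once, every `e` at most once.
    # I                                         ≤⟨ sum-mono bound ⟩
    sum (λ v → sum (λ e → ⟦ D e ∧ h e == v ⟧))  ≡⟨ ∑-comm (λ v e → ⟦ D e ∧ h e == v ⟧) ⟩
    sum (λ e → sum (λ v → ⟦ D e ∧ h e == v ⟧))  ≤⟨ sum-mono fibre ⟩
    # D                                         ∎
    where
    open ≤-Reasoning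
    bound : ∀ v → ⟦ I v ⟧ ≤ sum (λ e → ⟦ D e ∧ h e == v ⟧)
    bound v with I v in eq
    ... | false = z≤n
    ... | true with sur v eq
    ...   | e , De , refl = #-pos {f = λ e′ → D e′ ∧ h e′ == h e} e (true-∧ De (==-refl (h e)))
    fibre : ∀ e → sum (λ v → ⟦ D e ∧ h e == v ⟧) ≤ ⟦ D e ⟧
    fibre e with D e
    ... | false = ≤-reflexive (#-none {n} {λ v → false} (λ _ → refl))
    ... | true  = ≤-reflexive (#-single′ (h e))

  ∣∣≡# : ∀ {n} (S : Subset n) → ∣ S ∣ ≡ # (lookup S)
  ∣∣≡# []          = refl
  ∣∣≡# (true  ∷ S) = cong suc (∣∣≡# S)
  ∣∣≡# (false ∷ S) = ∣∣≡# S

#-pick : ∀ {n} (x : Fin n) (f : Fin n → Bool) → # (λ i → i == x ∧ f i) ≡ ⟦ f x ⟧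
#-pick x f with f x in fx
... | true  = trans (#-cong at-x) (#-single x)
  where
  at-x : ∀ i → i == x ∧ f i ≡ i == x
  at-x i with i ≟ x
  ... | yes refl = fx
  ... | no _     = refl
... | false = #-none at-x
  where
  at-x : ∀ i → i == x ∧ f i ≡ false
  at-x i with i ≟ x
  ... | yes refl = fx
  ... | no _     = refl

-- Excluded middle under a double negation

dne-all : ∀ {n p} {P : Fin n → Set p} → (∀ i → ¬ ¬ P i) → ¬ ¬ (∀ i → P i)
dne-all {zero}  h k = k (λ ())
dne-all {suc n} {P = P} h k = h zero (λ p₀ → dne-all (h ∘ suc) (λ ps → k (λ { zero → p₀ ; (suc i) → ps i })))

em : ∀ {p} {P : Set p} → ¬ ¬ Dec P
em k = k (no (λ p → k (yes p)))

-- When the goal is ⊥, any predicate on finitely many points may be taken as decidable. This spares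
-- decision procedures for `Leftover` and `Linked`.
decide-all : ∀ {n p} (P : Fin n → Set p) → ¬ ¬ (∀ i → Dec (P i))
decide-all P = dne-all (λ _ → em)

-- Walks, connectedness and edge counts

module Walks (G : Graph) where

  p₁ p₂ : Edge G → Vertex G
  p₁ e = proj₁ (ends G e)
  p₂ e = proj₂ (ends G e)

  joins : ∀ e → Joins G e (p₁ e) (p₂ e)
  joins e = inj₁ (refl , refl)

  flip : ∀ {e u v} → Joins G e u v → Joins G e v u
  flip (inj₁ (a , b)) = inj₂ (a , b)
  flip (inj₂ (a , b)) = inj₁ (a , b)

  -- An arbitrary predicate on edges covers walks in a tree, inside a vertex set or avoiding an edge
  -- alike, and lets `bind` reroute a walk from one predicate to another.
  data Path (P : Edge G → Set) : Vertex G → Vertex G → Set where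
    done : ∀ {u} → Path P u u
    via  : ∀ {u w v} e → P e → Joins G e u w → Path P w v → Path P u v

  infixr 5 _⁀_

  _⁀_ : ∀ {P u w v} → Path P u w → Path P w v → Path P u v
  done          ⁀ q = q
  via e pe j p  ⁀ q = via e pe j (p ⁀ q)

  edge : ∀ {P u v} e → P e → Joins G e u v → Path P u v
  edge e pe j = via e pe j done

  reverse : ∀ {P u v} → Path P u v → Path P v u
  reverse done          = done
  reverse (via e pe j p) = reverse p ⁀ edge e pe (flip j)

  bind : ∀ {P Q : Edge G → Set} → (∀ {e u w} → P e → Joins G e u w → Path Q u w) →
         ∀ {u v} → Path P u v → Path Q u v
  bind h done           = done
  bind h (via e pe j p) = h pe j ⁀ bind h p

  bind-ends : ∀ {P Q : Edge G → Set} → (∀ e → P e → Path Q (p₁ e) (p₂ e)) →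
              ∀ {u v} → Path P u v → Path Q u v
  bind-ends {P} {Q} h = bind go
    where
    go : ∀ {e u w} → P e → Joins G e u w → Path Q u w
    go {e} pe (inj₁ (refl , refl)) = h e pe
    go {e} pe (inj₂ (refl , refl)) = reverse (h e pe)

  weaken : ∀ {P Q : Edge G → Set} → (∀ e → P e → Q e) → ∀ {u v} → Path P u v → Path Q u v
  weaken h = bind (λ {e} pe j → edge e (h e pe) j)

  -- Two uses of `f` reduce to one or none: in the same direction, the part from the first up to the
  -- second is dropped; in opposite directions, both are dropped.
  split : ∀ {P : Edge G → Set} f {x y} → Path P x y →
          Path (λ e → P e × e ≢ f) x y ⊎
          (P f × ∃ λ p → ∃ λ q → Joins G f p q × Path (λ e → P e × e ≢ f) x p × Path (λ e → P e × e ≢ f) q y)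
  split f done = inj₁ done
  split f (via e pe j p) with e ≟ f | split f p
  ... | no e≢f | inj₁ p′ = inj₁ (via e (pe , e≢f) j p′)
  ... | no e≢f | inj₂ (pf , a , b , jf , q , r) = inj₂ (pf , a , b , jf , via e (pe , e≢f) j q , r)
  ... | yes refl | inj₁ p′ = inj₂ (pe , _ , _ , j , done , p′)
  ... | yes refl | inj₂ (_ , _ , _ , jf , _ , r) with j | jf
  ...   | inj₁ (refl , refl) | inj₁ (refl , refl) = inj₂ (pe , _ , _ , inj₁ (refl , refl) , done , r)
  ...   | inj₁ (refl , refl) | inj₂ (refl , refl) = inj₁ r
  ...   | inj₂ (refl , refl) | inj₁ (refl , refl) = inj₁ r
  ...   | inj₂ (refl , refl) | inj₂ (refl , refl) = inj₂ (pe , _ , _ , inj₂ (refl , refl) , done , r)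

  align : ∀ {P : Edge G → Set} {e p q} → Joins G e p q → Path P p q → Path P (p₁ e) (p₂ e)
  align (inj₁ (refl , refl)) r = r
  align (inj₂ (refl , refl)) r = reverse r

  entering : ∀ {P : Edge G → Set} (A : Vertex G → Bool) {u v} → Path P u v → A u ≡ false → A v ≡ true →
             ∃ λ e → ∃ λ w → ∃ λ w′ → P e × Joins G e w w′ × A w ≡ false × A w′ ≡ true
  entering A done au av = ⊥-elim (true≢false av au)
  entering A (via {w = w} e pe j p) au av with A w in eq
  ... | true  = e , _ , w , pe , j , au , eq
  ... | false = entering A p eq av

  Both : (Vertex G → Set) → Edge G → Set
  Both W e = W (p₁ e) × W (p₂ e)

  both : ∀ {W : Vertex G → Set} {e u v} → Joins G e u v → W u → W v → Both W e
  both (inj₁ (refl , refl)) wu wv = wu , wv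
  both (inj₂ (refl , refl)) wu wv = wv , wu

  closed : ∀ {P : Edge G → Set} {W : Vertex G → Set} → (∀ {e u w} → P e → Joins G e u w → W u → W w) →
           ∀ {u v} → Path P u v → W u → W v
  closed h done           wu = wu
  closed h (via e pe j p) wu = closed h p (h pe j wu)

  confine : ∀ {P : Edge G → Set} {W : Vertex G → Set} → (∀ {e u w} → P e → Joins G e u w → W u → W w) →
            ∀ {u v} → Path P u v → W u → Path (λ e → P e × Both W e) u v
  confine h done           wu = done
  confine h (via e pe j p) wu = via e (pe , both j wu (h pe j wu)) j (confine h p (h pe j wu))

  inside : (Vertex G → Bool) → Edge G → Bool
  inside A e = A (p₁ e) ∧ A (p₂ e)

  inside-joins : ∀ A {e u v} → Joins G e u v → inside A e ≡ true → A u ≡ true × A v ≡ true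
  inside-joins A (inj₁ (refl , refl)) h = ∧-true h
  inside-joins A (inj₂ (refl , refl)) h = proj₂ (∧-true h) , proj₁ (∧-true h)

  joins-inside : ∀ A {e u v} → Joins G e u v → A u ≡ true → A v ≡ true → inside A e ≡ true
  joins-inside A (inj₁ (refl , refl)) a b = true-∧ a b
  joins-inside A (inj₂ (refl , refl)) a b = true-∧ b a

  inside-mono : ∀ {A B e} → (∀ v → A v ≡ true → B v ≡ true) → inside A e ≡ true → inside B e ≡ true
  inside-mono {A} {B} {e} A⊆B h with ∧-true {A (p₁ e)} h
  ... | a , b = true-∧ {B (p₁ e)} (A⊆B _ a) (A⊆B _ b)

  -- Growing A to B one vertex at a time uses a new edge of T at every step.
  growth : ∀ (T : Edge G → Bool) (A B : Vertex G → Bool) →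
           (∀ v → A v ≡ true → B v ≡ true) →
           (∀ e → T e ≡ true → inside B e ≡ true) →
           (∀ v → B v ≡ true → ∃ λ a → A a ≡ true × Path (λ e → T e ≡ true) v a) →
           # B ≤ # A + # (λ e → T e ∧ not (inside A e))
  growth T A B A⊆B T⊆B reach = go (# B) A A⊆B reach (m≤n⇒m≤o+n (# A) ≤-refl)
    where
    go : ∀ k A → (∀ v → A v ≡ true → B v ≡ true) →
         (∀ v → B v ≡ true → ∃ λ a → A a ≡ true × Path (λ e → T e ≡ true) v a) →
         # B ≤ # A + k → # B ≤ # A + # (λ e → T e ∧ not (inside A e))
    go zero A _ _ h = ≤-trans h (+-monoʳ-≤ (# A) z≤n)
    go (suc k) A A⊆B reach h with any? (λ v → (B v Bool.≟ true) ×-dec (A v Bool.≟ false))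
    ... | no full = ≤-trans (#-mono B⊆A) (m≤m+n _ _)
      where
      B⊆A : ∀ v → B v ≡ true → A v ≡ true
      B⊆A v bv with A v in eq
      ... | true  = refl
      ... | false = ⊥-elim (full (v , bv , eq))
    ... | yes (v , bv , av) with reach v bv
    ...   | a , aa , p with entering A p av aa
    ...     | e , w , w′ , te , j , aw , aw′ =
      ≤-trans (go k (A ⊞ w) sub reach′ (≤-trans h (≤-reflexive (trans (+-suc (# A) k) (cong (_+ k) (sym (#-⊞ A aw)))))))
        (≤-trans (≤-reflexive (trans (cong (_+ rest (A ⊞ w)) (#-⊞ A aw)) (sym (+-suc (# A) _))))
                 (+-monoʳ-≤ (# A) (#-mono-< shrink e gone here′)))
      where
      rest : (Vertex G → Bool) → ℕ
      rest A = # (λ e → T e ∧ not (inside A e))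
      A⊆A⊞w : ∀ {v} → A v ≡ true → (A ⊞ w) v ≡ true
      A⊆A⊞w = ∨-trueˡ
      sub : ∀ v → (A ⊞ w) v ≡ true → B v ≡ true
      sub v h with ∨-true {A v} h
      ... | inj₁ av = A⊆B v av
      ... | inj₂ vw with refl ← ==⇒≡ {i = v} vw = proj₁ (inside-joins B j (T⊆B e te))
      reach′ : ∀ v → B v ≡ true → ∃ λ a → (A ⊞ w) a ≡ true × Path (λ e → T e ≡ true) v a
      reach′ v bv with reach v bv
      ... | a , aa , p = a , A⊆A⊞w aa , p
      shrink : ∀ e → T e ∧ not (inside (A ⊞ w) e) ≡ true → T e ∧ not (inside A e) ≡ true
      shrink e h with ∧-true {T e} h
      ... | te , out = true-∧ te (true-not (¬true⇒false λ ins →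
        true≢false (inside-mono {A} {A ⊞ w} {e} (λ _ → A⊆A⊞w) ins) (not-true out)))
      gone : T e ∧ not (inside (A ⊞ w) e) ≡ false
      gone = ¬true⇒false λ h → true≢false (joins-inside (A ⊞ w) j (⊞-self A w) (A⊆A⊞w aw′)) (not-true (proj₂ (∧-true {T e} h)))
      here′ : T e ∧ not (inside A e) ≡ true
      here′ = true-∧ te (true-not (¬true⇒false λ ins → true≢false (proj₁ (inside-joins A j ins)) aw))

  Spans : (Edge G → Bool) → Set
  Spans T = ∀ u v → Path (λ e → T e ≡ true) u v

  spans⇒≤ : ∀ T → Spans T → Vertex G → n G ≤ suc (# T)
  spans⇒≤ T conn r = begin
    n G                                                   ≡⟨ #-all (n G) ⟨
    # (λ (_ : Vertex G) → true)                            ≤⟨ growth T (_== r) (λ _ → true) (λ _ _ → refl) (λ _ _ → refl)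
                                                               (λ v _ → r , ==-refl r , conn v r) ⟩
    # (_== r) + # (λ e → T e ∧ not (inside (_== r) e))     ≡⟨ cong (_+ # (λ e → T e ∧ not (inside (_== r) e))) (#-single r) ⟩
    suc (# (λ e → T e ∧ not (inside (_== r) e)))           ≤⟨ s≤s (#-mono (λ e h → proj₁ (∧-true h))) ⟩
    suc (# T)                                             ∎
    where open ≤-Reasoning

  -- A vertex set grows from `r`, and each new vertex brings exactly one edge of `T`, which fixes
  -- the number of edges at n - 1.
  prune : ∀ T → Spans T → (r : Vertex G) →
          ∃ λ F → (∀ e → F e ≡ true → T e ≡ true) × Spans F × suc (# F) ≡ n G
  prune T conn r = go (n G) (_== r) (λ _ → false) (λ _ ()) (λ _ ()) start (==-refl r)
                      (trans (cong suc (#-none {f = λ (_ : Edge G) → false} (λ _ → refl))) (sym (#-single r)))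
                      (m≤n+m _ _)
    where
    start : ∀ v → v == r ≡ true → Path (λ (_ : Edge G) → false ≡ true) r v
    start v h with refl ← ==⇒≡ {i = v} h = done
    go : ∀ k A F → (∀ e → F e ≡ true → T e ≡ true) → (∀ e → F e ≡ true → inside A e ≡ true) →
         (∀ v → A v ≡ true → Path (λ e → F e ≡ true) r v) → A r ≡ true → suc (# F) ≡ # A → n G ≤ # A + k →
         ∃ λ F → (∀ e → F e ≡ true → T e ≡ true) × Spans F × suc (# F) ≡ n G
    go k A F F⊆T F⊆A reach ar size fuel with any? (λ v → A v Bool.≟ false)
    ... | no full = F , F⊆T , (λ u v → reverse (reach u (all u)) ⁀ reach v (all v)) ,
                    trans size (trans (#-cong all) (#-all (n G)))
      where
      all : ∀ v → A v ≡ true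
      all v with A v in eq
      ... | true  = refl
      ... | false = ⊥-elim (full (v , eq))
    go zero A F F⊆T F⊆A reach ar size fuel | yes (v , av) =
      ⊥-elim (<-irrefl refl (≤-trans (#-mono-< {f = A} {g = λ _ → true} (λ _ _ → refl) v av refl)
        (≤-trans (≤-reflexive (#-all (n G))) (≤-trans fuel (≤-reflexive (+-identityʳ _))))))
    go (suc k) A F F⊆T F⊆A reach ar size fuel | yes (v , av) with entering A (conn v r) av ar
    ... | e , w , w′ , te , j , aw , aw′ =
      go k (A ⊞ w) (F ⊞ e) sub ins reach′ (∨-trueˡ ar) (trans (cong suc (#-⊞ F fe)) (trans (cong suc size) (sym (#-⊞ A aw))))
         (≤-trans fuel (≤-reflexive (trans (+-suc (# A) k) (cong (_+ k) (sym (#-⊞ A aw))))))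
      where
      fe : F e ≡ false
      fe = ¬true⇒false λ h → true≢false (proj₁ (inside-joins A j (F⊆A e h))) aw
      sub : ∀ f → (F ⊞ e) f ≡ true → T f ≡ true
      sub f h with ∨-true {F f} h
      ... | inj₁ ff = F⊆T f ff
      ... | inj₂ fe with refl ← ==⇒≡ {i = f} fe = te
      ins : ∀ f → (F ⊞ e) f ≡ true → inside (A ⊞ w) f ≡ true
      ins f h with ∨-true {F f} h
      ... | inj₁ ff = inside-mono {A} {A ⊞ w} {f} (λ _ → ∨-trueˡ) (F⊆A f ff)
      ... | inj₂ fe with refl ← ==⇒≡ {i = f} fe = joins-inside (A ⊞ w) j (⊞-self A w) (∨-trueˡ aw′)
      reach′ : ∀ v → (A ⊞ w) v ≡ true → Path (λ f → (F ⊞ e) f ≡ true) r v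
      reach′ v h with ∨-true {A v} h
      ... | inj₁ av = weaken (λ _ → ∨-trueˡ) (reach v av)
      ... | inj₂ vw with refl ← ==⇒≡ {i = v} vw = weaken (λ _ → ∨-trueˡ) (reach w′ aw′) ⁀ edge e (⊞-self F e) (flip j)

-- Exchanging edges between two disjoint trees

module Swaps (G : Graph) where

  open Walks G

  -- A colouring encodes two disjoint edge sets: just i marks the edges of tree i.
  Colouring : Set
  Colouring = Edge G → Maybe Bool

  has : Bool → Maybe Bool → Bool
  has i (just j) = does (i Bool.≟ j)
  has i nothing  = false

  has-self : ∀ i → has i (just i) ≡ true
  has-self i = dec-true (i Bool.≟ i) refl

  has⇒≡ : ∀ i x → has i x ≡ true → x ≡ just i
  has⇒≡ i (just j) h = cong just (sym (does⇒ (i Bool.≟ j) h))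

  has-free : ∀ {i} {x : Maybe Bool} → has i x ≡ true → x ≡ nothing → ⊥
  has-free () refl

  Tree : Colouring → Bool → Edge G → Set
  Tree c i e = has i (c e) ≡ true

  -- Trees enter as connected sets of n - 1 edges: exchanges and mixtures control edge counts by
  -- pure bookkeeping.
  record Packing (c : Colouring) : Set where
    field
      spans : ∀ i → Spans (λ e → has i (c e))
      size  : ∀ i → suc (# (λ e → has i (c e))) ≡ n G
  open Packing

  -- In a packing, a nonempty tight `W` carries the largest possible number 2(|W| - 1) of tree
  -- edges, so an uncoloured edge inside `W` is dependent on them.
  TightIn : Colouring → (Vertex G → Set) → Set
  TightIn c W = ∀ i {u v} → W u → W v → Path (λ e → Tree c i e × Both W e) u v

  inc : Vertex G → Edge G → Bool
  inc v e = p₁ e == v ∨ p₂ e == v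

  deg : Colouring → Vertex G → ℕ
  deg c v = # (λ e → is-just (c e) ∧ inc v e)

  swap : Colouring → Edge G → Edge G → Bool → Colouring
  swap c h f i e with e ≟ h | e ≟ f
  ... | yes _ | _     = just i
  ... | no  _ | yes _ = nothing
  ... | no  _ | no  _ = c e

  swap-new : ∀ c h f i → swap c h f i h ≡ just i
  swap-new c h f i with h ≟ h | h ≟ f
  ... | yes _ | _     = refl
  ... | no ¬q | _ = ⊥-elim (¬q refl)

  swap-old : ∀ c {h f i e} → e ≢ h → e ≢ f → swap c h f i e ≡ c e
  swap-old c {h} {f} {i} {e} e≢h e≢f with e ≟ h | e ≟ f
  ... | yes q | _     = ⊥-elim (e≢h q)
  ... | no  _ | yes q = ⊥-elim (e≢f q)
  ... | no  _ | no  _ = refl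

  swap-gone : ∀ c {h f i} → f ≢ h → swap c h f i f ≡ nothing
  swap-gone c {h} {f} f≢h with f ≟ h | f ≟ f
  ... | yes q | _     = ⊥-elim (f≢h q)
  ... | no  _ | yes _ = refl
  ... | no  _ | no ¬q = ⊥-elim (¬q refl)

  swap-size : ∀ c {h f i} → c h ≡ nothing → Tree c i f →
              ∀ j → # (λ e → has j (swap c h f i e)) ≡ # (λ e → has j (c e))
  -- The lost edge is added back on both sides, so that the edge-by-edge identity needs no
  -- subtraction.
  swap-size c {h} {f} {i} free tf j = +-cancelʳ-≡ (#_ {m G} (λ e → e == f ∧ δ)) _ _
    (trans (#-+ pt) (cong (# (λ e → has j (c e)) +_) (trans (#-pick h (λ _ → δ)) (sym (#-pick f (λ _ → δ))))))
    where
    δ : Bool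
    δ = has j (just i)
    pt : ∀ e → ⟦ has j (swap c h f i e) ⟧ + ⟦ e == f ∧ δ ⟧ ≡ ⟦ has j (c e) ⟧ + ⟦ e == h ∧ δ ⟧
    pt e with e ≟ h | e ≟ f
    ... | yes refl | yes refl = ⊥-elim (has-free {i} tf free)
    ... | yes refl | no  _    = trans (+-identityʳ _) (cong (λ x → ⟦ has j x ⟧ + ⟦ δ ⟧) (sym free))
    ... | no  _    | yes refl = sym (trans (+-identityʳ _) (cong (λ x → ⟦ has j x ⟧) (has⇒≡ i (c f) tf)))
    ... | no  _    | no  _    = refl

  swap-used : ∀ c {h f i} → c h ≡ nothing → Tree c i f →
              ∀ e → ⟦ is-just (swap c h f i e) ⟧ + ⟦ e == f ⟧ ≡ ⟦ is-just (c e) ⟧ + ⟦ e == h ⟧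
  swap-used c {h} {f} {i} free tf e with e ≟ h | e ≟ f
  ... | yes refl | yes refl = ⊥-elim (has-free {i} tf free)
  ... | yes refl | no  _    = cong (λ x → ⟦ is-just x ⟧ + 1) (sym free)
  ... | no  _    | yes refl = cong (λ x → ⟦ is-just x ⟧ + 0) (sym (has⇒≡ i (c f) tf))
  ... | no  _    | no  _    = refl

  module Exchange (c₀ : Colouring) (W : Vertex G → Set) (g : Edge G)
                  (tight₀ : TightIn c₀ W) (free₀ : c₀ g ≡ nothing) (g∈W : Both W g) where

    TreeW : Colouring → Bool → Edge G → Set
    TreeW c i e = Tree c i e × Both W e

    -- The configurations (c , h) reachable from (c₀ , g): the edges of c₀ together with g are
    -- redistributed among the two trees and the left-over edge h.
    data Reachable : Colouring → Edge G → Set where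
      start : Reachable c₀ g
      move  : ∀ {c h} → Reachable c h → ∀ i f {x y p q} → Tree c i f → Both W f → Joins G h x y → Joins G f p q →
              Path (λ e → TreeW c i e × e ≢ f) x p → Path (λ e → TreeW c i e × e ≢ f) q y →
              Reachable (swap c h f i) f

    -- The invariants of a sequence of moves. `used≡` says that `c` together with `h` uses the same
    -- edges as `c₀` together with `g`.
    record State (c : Colouring) (h : Edge G) : Set where
      field
        free    : c h ≡ nothing
        within  : Both W h
        tight   : TightIn c W
        outside : ∀ e → c e ≡ c₀ e ⊎ Both W e
        size≡   : ∀ j → # (λ e → has j (c e)) ≡ # (λ e → has j (c₀ e))
        used≡   : ∀ e → ⟦ is-just (c e) ⟧ + ⟦ e == h ⟧ ≡ ⟦ is-just (c₀ e) ⟧ + ⟦ e == g ⟧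

    state : ∀ {c h} → Reachable c h → State c h
    state start = record
      { free = free₀ ; within = g∈W ; tight = tight₀ ; outside = λ _ → inj₁ refl
      ; size≡ = λ _ → refl ; used≡ = λ _ → refl }
    state (move {c} {h} r i f {x} {y} {p} {q} tf f∈W jh jf x⇝p q⇝y) = record
      { free    = swap-gone c f≢h
      ; within  = f∈W
      ; tight   = λ j u v → bind-ends (reroute j) (tight j u v)
      ; outside = out
      ; size≡   = λ j → trans (swap-size c free tf j) (size≡ j)
      ; used≡   = λ e → trans (swap-used c free tf e) (used≡ e)
      }
      where
      open State (state r)
      f≢h : f ≢ h
      f≢h refl = has-free {i} tf free
      keep : ∀ j e → TreeW c j e → e ≢ f → TreeW (swap c h f i) j e
      keep j e (te , e∈W) e≢f = trans (cong (has j) (swap-old c e≢h e≢f)) te , e∈W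
        where
        e≢h : e ≢ h
        e≢h refl = has-free {j} te free
      reroute : ∀ j e → TreeW c j e → Path (TreeW (swap c h f i) j) (p₁ e) (p₂ e)
      reroute j e te with e ≟ f
      ... | no e≢f = edge e (keep j e te e≢f) (joins e)
      ... | yes refl with trans (sym (has⇒≡ j (c e) (proj₁ te))) (has⇒≡ i (c f) tf)
      -- A walk that used `f` from `p` to `q` now goes back from `p` to `x`, across `h`, and back
      -- from `y` to `q`.
      ...   | refl = align jf (reverse (weaken (λ e (t , d) → keep i e t d) x⇝p) ⁀
                       via h (trans (cong (has i) (swap-new c h f i)) (has-self i) , within) jh
                       (reverse (weaken (λ e (t , d) → keep i e t d) q⇝y)))
      out : ∀ e → swap c h f i e ≡ c₀ e ⊎ Both W e
      out e with e ≟ h | e ≟ f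
      ... | yes refl | _        = inj₂ within
      ... | no  _    | yes refl = inj₂ f∈W
      ... | no  _    | no  _    = outside e

    Leftover : Edge G → Set
    Leftover f = ∃ λ c → Reachable c f

    module _ (leftover? : ∀ f → Dec (Leftover f)) where

      TreeK : Colouring → Bool → Edge G → Set
      TreeK c i e = TreeW c i e × Leftover e

      -- If removing f from tree i separated the ends of h, then f could be swapped for h and be left over.
      joined : ∀ {c h} → Reachable c h → ∀ i → Path (TreeK c i) (p₁ h) (p₂ h)
      joined {c} {h} r i = weaken at-end (remove (allFin (m G)))
        where
        open State (state r)
        Rest : List (Edge G) → Edge G → Set
        Rest L e = TreeW c i e × (Leftover e ⊎ ¬ (e ∈ₗ L))
        remove : ∀ L → Path (Rest L) (p₁ h) (p₂ h)
        remove [] = weaken (λ _ t → t , inj₂ (λ ())) (tight i (proj₁ within) (proj₂ within))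
        remove (f ∷ L) with leftover? f
        ... | yes kf = weaken add (remove L)
          where
          add : ∀ e → Rest L e → Rest (f ∷ L) e
          add e (t , inj₁ k) = t , inj₁ k
          add e (t , inj₂ k) with e ≟ f
          ... | yes refl = t , inj₁ kf
          ... | no  e≢f  = t , inj₂ λ { (here q) → e≢f q ; (there q) → k q }
        ... | no ¬kf with split f (remove L)
        ...   | inj₁ p = weaken drop p
          where
          drop : ∀ e → Rest L e × e ≢ f → Rest (f ∷ L) e
          drop e ((t , inj₁ k) , _)   = t , inj₁ k
          drop e ((t , inj₂ k) , e≢f) = t , inj₂ λ { (here q) → e≢f q ; (there q) → k q }
        ...   | inj₂ (((tf , f∈W) , _) , p , q , jf , a , b) =
          ⊥-elim (¬kf (_ , move r i f tf f∈W (joins h) jf (weaken tree a) (weaken tree b)))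
          where
          tree : ∀ e → Rest L e × e ≢ f → TreeW c i e × e ≢ f
          tree e ((t , _) , e≢f) = t , e≢f
        at-end : ∀ e → Rest (allFin (m G)) e → TreeK c i e
        at-end e (t , inj₁ k) = t , k
        at-end e (t , inj₂ k) = ⊥-elim (k (∈-allFin e))

      -- Moves are undone one by one: the only edge gained by a move is `h`, and by `joined` its
      -- ends were already connected by leftover edges of the same tree.
      pull-back : ∀ {c h} → Reachable c h → ∀ i {u v} → Path (TreeK c i) u v → Path (TreeK c₀ i) u v
      pull-back start i p = p
      pull-back (move {c} {h} r i f tf f∈W jh jf a b) j p = pull-back r j (bind-ends undo p)
        where
        open State (state r)
        undo : ∀ e → TreeK (swap c h f i) j e → Path (TreeK c j) (p₁ e) (p₂ e)
        undo e ((t , e∈W) , k) with e ≟ h | e ≟ f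
        ... | yes refl | _ with refl ← does⇒ (j Bool.≟ i) t = joined r i
        undo e ((() , e∈W) , k) | no _ | yes refl
        ... | no _ | no _ = edge e ((t , e∈W) , k) (joins e)

      leftover-spanned : ∀ f → Leftover f → ∀ i → Path (TreeK c₀ i) (p₁ f) (p₂ f)
      leftover-spanned f (c , r) i = pull-back r i (joined r i)

      -- The vertices of the circuit that `g` closes in the union of the two graphic matroids.
      Circuit : Vertex G → Set
      Circuit v = Path Leftover (p₁ g) v

      circuit-step : ∀ {e u w} → Leftover e → Joins G e u w → Circuit u → Circuit w
      circuit-step k j p = p ⁀ edge _ k j

      -- Each leftover edge can be replaced, in either tree of `c₀`, by a walk of leftover edges,
      -- and such walks never leave the circuit.
      circuit-tight : TightIn c₀ Circuit
      circuit-tight i {u} {v} pu pv =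
        weaken (λ e ((t , _) , b) → proj₁ t , b)
          (confine (λ (_ , k) → circuit-step k) (bind-ends (λ f k → leftover-spanned f k i) (reverse pu ⁀ pv)) pu)

      circuit⊆W : ∀ {v} → Circuit v → W v
      circuit⊆W p = closed follow p (proj₁ g∈W)
        where
        follow : ∀ {e u w} → Leftover e → Joins G e u w → W u → W w
        follow (_ , r) (inj₁ (refl , refl)) _ = proj₂ (State.within (state r))
        follow (_ , r) (inj₂ (refl , refl)) _ = proj₁ (State.within (state r))

      circuit-avoids : ∀ z → p₁ g ≢ z → (∀ f → Leftover f → inc z f ≡ false) → ¬ Circuit z
      circuit-avoids z g≢z none p with entering (_== z) p (≢⇒== g≢z) (==-refl z)
      ... | f , w , w′ , k , j , _ , w′z with refl ← ==⇒≡ {i = w′} w′z = true≢false (touches j) (none f k)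
        where
        touches : ∀ {w} → Joins G f w z → inc z f ≡ true
        touches (inj₁ (refl , refl)) = ∨-trueʳ {p₁ f == z} (==-refl z)
        touches (inj₂ (refl , refl)) = ∨-trueˡ (==-refl z)

-- Barriers around a vertex of degree at least 6 in an optimal pair of trees

module Barriers (G : Graph) where

  open Walks G
  open Swaps G

  excess : Colouring → Vertex G → ℕ
  excess c v = deg c v ∸ 5  -- truncated: vertices of degree below 5 contribute 0

  total : Colouring → ℕ
  total c = sum (excess c)

  inc-ends : ∀ {v e} → inc v e ≡ true → p₁ e ≡ v ⊎ p₂ e ≡ v
  inc-ends {v} {e} h with ∨-true {p₁ e == v} h
  ... | inj₁ q = inj₁ (==⇒≡ {i = p₁ e} q)
  ... | inj₂ q = inj₂ (==⇒≡ {i = p₂ e} q)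

  inc-miss : ∀ {v e} → p₁ e ≢ v → p₂ e ≢ v → inc v e ≡ false
  inc-miss a b rewrite ≢⇒== a | ≢⇒== b = refl

  false⇒≢ : ∀ {S : Vertex G → Bool} {x z} → S x ≡ false → S z ≡ true → x ≢ z
  false⇒≢ sx sz refl = true≢false sz sx

  module Minimal (b : Colouring) (packed : Packing b) (minimal : ∀ c → Packing c → total b ≤ total c) where

    -- u and v lie in a common 2-tree-connected subgraph of b avoiding S.
    record Linked (S : Vertex G → Bool) (u v : Vertex G) : Set where
      field
        W      : Vertex G → Bool
        avoids : ∀ w → W w ≡ true → S w ≡ false
        tight  : TightIn b (λ w → W w ≡ true)
        u∈W    : W u ≡ true
        v∈W    : W v ≡ true

    linked-refl : ∀ {S v} → S v ≡ false → Linked S v v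
    linked-refl {S} {v} sv = record
      { W = _== v ; avoids = λ w h → trans (cong S (==⇒≡ {i = w} h)) sv ; tight = λ i {x} {y} → trivial i x y
      ; u∈W = ==-refl v ; v∈W = ==-refl v }
      where
      trivial : ∀ i x y → x == v ≡ true → y == v ≡ true → Path (λ e → Tree b i e × Both (λ w → w == v ≡ true) e) x y
      trivial i x y hx hy with refl ← ==⇒≡ {i = x} hx | refl ← ==⇒≡ {i = y} hy = done

    linked-sym : ∀ {S u v} → Linked S u v → Linked S v u
    linked-sym l = record { W = W ; avoids = avoids ; tight = tight ; u∈W = v∈W ; v∈W = u∈W }
      where open Linked l

    -- Tight sets that share a vertex have a tight union. Hence the classes partition the complement
    -- of `S`.
    linked-trans : ∀ {S u v w} → Linked S u v → Linked S v w → Linked S u w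
    linked-trans {S} {u} {v} {w} l l′ = record
      { W = U ; avoids = out ; tight = λ i hx hy → centre i hx ⁀ reverse (centre i hy)
      ; u∈W = ∨-trueˡ L.u∈W ; v∈W = ∨-trueʳ {L.W w} L′.v∈W }
      where
      module L = Linked l
      module L′ = Linked l′
      U : Vertex G → Bool
      U x = L.W x ∨ L′.W x
      out : ∀ x → U x ≡ true → S x ≡ false
      out x h with ∨-true {L.W x} h
      ... | inj₁ q = L.avoids x q
      ... | inj₂ q = L′.avoids x q
      centre : ∀ i {x} → U x ≡ true → Path (λ e → Tree b i e × Both (λ x → U x ≡ true) e) x v
      centre i {x} h with ∨-true {L.W x} h
      ... | inj₁ q = weaken (λ e (t , p , q) → t , ∨-trueˡ p , ∨-trueˡ q) (L.tight i q L.v∈W)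
      ... | inj₂ q = weaken (λ e (t , p , q) → t , ∨-trueʳ {L.W (p₁ e)} p , ∨-trueʳ {L.W (p₂ e)} q) (L′.tight i q L′.u∈W)

    linked-left : ∀ {S u v} → Linked S u v → S u ≡ false
    linked-left l = Linked.avoids l _ (Linked.u∈W l)

    linked-right : ∀ {S u v} → Linked S u v → S v ≡ false
    linked-right l = Linked.avoids l _ (Linked.v∈W l)

    linked-anti : ∀ {S S′ u v} → (∀ w → S w ≡ true → S′ w ≡ true) → Linked S′ u v → Linked S u v
    linked-anti {S} S⊆S′ l = record
      { W = W ; avoids = λ w h → ¬true⇒false (λ s → true≢false (S⊆S′ w s) (avoids w h))
      ; tight = tight ; u∈W = u∈W ; v∈W = v∈W }
      where open Linked l

    linked-path : ∀ {S u v} → Linked S u v → ∀ i → Path (λ e → Tree b i e × Both (Linked S u) e) u v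
    linked-path l i = weaken (λ e (t , p , q) → t , member p , member q) (tight i u∈W v∈W)
      where
      open Linked l
      member : ∀ {w} → W w ≡ true → Linked _ _ w
      member h = record { W = W ; avoids = avoids ; tight = tight ; u∈W = u∈W ; v∈W = h }

    -- Contracting the classes makes `c` and `b` equal; inside each class the two trees may be
    -- chosen anew, independently of the other classes.
    record Rearranged (S : Vertex G → Bool) (c : Colouring) : Set where
      field
        agree : ∀ e → c e ≡ b e ⊎ Linked S (p₁ e) (p₂ e)
        tight : ∀ i {u v} → Linked S u v → Path (λ e → Tree c i e × Both (Linked S u) e) u v

    -- By minimality of `b`, the field `small` makes every variant optimal as well.
    record Variant (S : Vertex G → Bool) (c : Colouring) : Set where
      field
        rearranged : Rearranged S c
        packing    : Packing c
        small      : total c ≤ total b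
      open Rearranged rearranged public

    -- A walk in a tree of `b` survives: a recoloured edge has both ends in one class, where the
    -- trees of `c` are connected.
    rearranged-spans : ∀ {S c} → Rearranged S c → ∀ i → Spans (λ e → has i (c e))
    rearranged-spans {S} {c} r i u v = bind-ends reroute (Packing.spans packed i u v)
      where
      open Rearranged r
      reroute : ∀ e → Tree b i e → Path (Tree c i) (p₁ e) (p₂ e)
      reroute e t with agree e
      ... | inj₁ q = edge e (trans (cong (has i) q) t) (joins e)
      ... | inj₂ l = weaken (λ _ → proj₁) (tight i l)

    variant-base : ∀ {S} → Variant S b
    variant-base = record
      { rearranged = record { agree = λ _ → inj₁ refl ; tight = λ i l → linked-path l i }
      ; packing = packed ; small = ≤-refl }

    -- A larger set has finer classes and therefore allows fewer rearrangements.
    variant-anti : ∀ {S S′ c} → (∀ w → S w ≡ true → S′ w ≡ true) → Variant S′ c → Variant S c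
    variant-anti {S} {S′} {c} S⊆S′ r = record
      { rearranged = record { agree = agree′ ; tight = λ i l → bind-ends (reroute i) (linked-path l i) }
      ; packing = packing ; small = small }
      where
      open Variant r
      agree′ : ∀ e → c e ≡ b e ⊎ Linked S (p₁ e) (p₂ e)
      agree′ e with agree e
      ... | inj₁ q = inj₁ q
      ... | inj₂ l = inj₂ (linked-anti S⊆S′ l)
      reroute : ∀ {u} i e → Tree b i e × Both (Linked S u) e → Path (λ e → Tree c i e × Both (Linked S u) e) (p₁ e) (p₂ e)
      reroute i e (t , lp , lq) with agree e
      ... | inj₁ q = edge e (trans (cong (has i) q) t , lp , lq) (joins e)
      ... | inj₂ l = weaken (λ _ (t , p , q) → t , linked-trans lp (linked-anti S⊆S′ p) , linked-trans lp (linked-anti S⊆S′ q))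
                            (tight i l)

    -- An edge at a vertex of `S` lies in no class, so it keeps its status.
    variant-deg : ∀ {S c z} → Variant S c → S z ≡ true → deg c z ≡ deg b z
    variant-deg {S} {c} {z} r sz = #-cong same
      where
      open Variant r
      same : ∀ e → is-just (c e) ∧ inc z e ≡ is-just (b e) ∧ inc z e
      same e with agree e
      ... | inj₁ q = cong (λ x → is-just x ∧ inc z e) q
      ... | inj₂ l rewrite inc-miss {z} {e} (false⇒≢ (linked-left l) sz) (false⇒≢ (linked-right l) sz)
        with is-just (c e) | is-just (b e)
      ...   | true  | true  = refl
      ...   | true  | false = refl
      ...   | false | true  = refl
      ...   | false | false = refl

    -- The invariant under which `S` grows. In an optimal rearrangement, an uncoloured edge with
    -- both ends of degree at most 4 could be swapped in without creating excess; no such edge may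
    -- run between classes.
    Blocked : (Vertex G → Bool) → Set
    Blocked S = ∀ c → Variant S c → ∀ g → c g ≡ nothing → S (p₁ g) ≡ false → S (p₂ g) ≡ false →
                ¬ Linked S (p₁ g) (p₂ g) → deg c (p₁ g) ≤ 4 → deg c (p₂ g) ≤ 4 → ⊥

    -- With nothing removed, both trees span the whole vertex set: there is a single class and
    -- nothing crosses.
    blocked-empty : Blocked (λ _ → false)
    blocked-empty c r g _ _ _ nl _ _ = nl (record
      { W = λ _ → true ; avoids = λ _ _ → refl
      ; tight = λ i {u} {v} _ _ → weaken (λ _ t → t , refl , refl) (Packing.spans packed i u v)
      ; u∈W = refl ; v∈W = refl })

    -- Either some possible left-over edge meets z, and the exchange lowers the degree of z without raising any excess,
    -- or the circuit of g avoids z and links the ends of g outside S ⊞ z.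
    module Step (S : Vertex G → Bool) (z : Vertex G) (sz : S z ≡ false)
                (heavy : 6 ≤ deg b z ⊎ (∀ c → Variant S c → 5 ≤ deg c z))
                (c : Colouring) (var : Variant (S ⊞ z) c) (g : Edge G) (free : c g ≡ nothing)
                (s₁ : (S ⊞ z) (p₁ g) ≡ false) (s₂ : (S ⊞ z) (p₂ g) ≡ false)
                (d₁ : deg c (p₁ g) ≤ 4) (d₂ : deg c (p₂ g) ≤ 4)
                (linked : Linked S (p₁ g) (p₂ g)) where

      S⊆ : ∀ w → S w ≡ true → (S ⊞ z) w ≡ true
      S⊆ _ = ∨-trueˡ

      var′ : Variant S c
      var′ = variant-anti S⊆ var

      Class : Vertex G → Set
      Class = Linked S (p₁ g)

      class-tight : TightIn c Class
      class-tight i lu lv =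
        weaken (λ _ (t , p , q) → t , linked-trans lu p , linked-trans lu q)
               (Variant.tight var′ i (linked-trans (linked-sym lu) lv))

      open Exchange c Class g class-tight free (linked-refl (linked-left linked) , linked)

      ≢z : ∀ {x} → (S ⊞ z) x ≡ false → x ≢ z
      ≢z h = false⇒≢ h (⊞-self S z)

      improve : ∀ c′ f → Reachable c′ f → inc z f ≡ true → ⊥
      improve c′ f r zf = <-irrefl refl (<-≤-trans smaller (≤-trans (Variant.small var) (minimal c′ packing′)))
        where
        open State (state r) hiding (free)
        reroute : ∀ i {Q : Edge G → Set} → (∀ {e e′} → Q e → Both Class e → Both Class e′ → Q e′) →
                  ∀ e → Tree c i e × Q e → Path (λ e → Tree c′ i e × Q e) (p₁ e) (p₂ e)
        reroute i spread e (t , q) with outside e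
        ... | inj₁ eq        = edge e (trans (cong (has i) eq) t , q) (joins e)
        ... | inj₂ (cp , cq) = weaken (λ _ (t , b) → t , spread q (cp , cq) b) (tight i cp cq)
        packing′ : Packing c′
        packing′ = record
          { spans = λ i u v → weaken (λ _ → proj₁) (bind-ends (reroute i {λ _ → ⊤} (λ _ _ _ → tt))
                                (weaken (λ _ t → t , tt) (Packing.spans (Variant.packing var) i u v)))
          ; size  = λ i → trans (cong suc (size≡ i)) (Packing.size (Variant.packing var) i) }
        rearranged′ : Rearranged S c′
        rearranged′ = record
          { agree = agree′
          ; tight = λ i {u} l → bind-ends (reroute i {Both (Linked S u)} (λ (q , _) (p , _) (p′ , q′) →
              let u~x = linked-trans q (linked-sym p) in linked-trans u~x p′ , linked-trans u~x q′))
              (Variant.tight var′ i l) }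
          where
          agree′ : ∀ e → c′ e ≡ b e ⊎ Linked S (p₁ e) (p₂ e)
          agree′ e with outside e
          ... | inj₂ (p , q) = inj₂ (linked-trans (linked-sym p) q)
          ... | inj₁ eq with Variant.agree var′ e
          ...   | inj₁ eq′ = inj₁ (trans eq eq′)
          ...   | inj₂ l   = inj₂ l
        deg≡ : ∀ v → deg c′ v + ⟦ inc v f ⟧ ≡ deg c v + ⟦ inc v g ⟧
        deg≡ v = begin
          deg c′ v + ⟦ inc v f ⟧                    ≡⟨ cong (deg c′ v +_) (#-pick f (inc v)) ⟨
          deg c′ v + # (λ e → e == f ∧ inc v e)     ≡⟨ #-+ pointwise ⟩
          deg c v + # (λ e → e == g ∧ inc v e)      ≡⟨ cong (deg c v +_) (#-pick g (inc v)) ⟩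
          deg c v + ⟦ inc v g ⟧                     ∎
          where
          open ≡-Reasoning
          pointwise : ∀ e → ⟦ is-just (c′ e) ∧ inc v e ⟧ + ⟦ e == f ∧ inc v e ⟧ ≡
                            ⟦ is-just (c e) ∧ inc v e ⟧ + ⟦ e == g ∧ inc v e ⟧
          pointwise e = restrict (is-just (c′ e)) (e == f) (is-just (c e)) (e == g) (inc v e) (used≡ e)
            where
            restrict : ∀ a b c d x → ⟦ a ⟧ + ⟦ b ⟧ ≡ ⟦ c ⟧ + ⟦ d ⟧ → ⟦ a ∧ x ⟧ + ⟦ b ∧ x ⟧ ≡ ⟦ c ∧ x ⟧ + ⟦ d ∧ x ⟧
            restrict a b c d x h = begin
              ⟦ a ∧ x ⟧ + ⟦ b ∧ x ⟧          ≡⟨ cong₂ _+_ (∧-* a x) (∧-* b x) ⟩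
              ⟦ a ⟧ * ⟦ x ⟧ + ⟦ b ⟧ * ⟦ x ⟧  ≡⟨ *-distribʳ-+ ⟦ x ⟧ ⟦ a ⟧ ⟦ b ⟧ ⟨
              (⟦ a ⟧ + ⟦ b ⟧) * ⟦ x ⟧        ≡⟨ cong (_* ⟦ x ⟧) h ⟩
              (⟦ c ⟧ + ⟦ d ⟧) * ⟦ x ⟧        ≡⟨ *-distribʳ-+ ⟦ x ⟧ ⟦ c ⟧ ⟦ d ⟧ ⟩
              ⟦ c ⟧ * ⟦ x ⟧ + ⟦ d ⟧ * ⟦ x ⟧  ≡⟨ cong₂ _+_ (∧-* c x) (∧-* d x) ⟨
              ⟦ c ∧ x ⟧ + ⟦ d ∧ x ⟧          ∎
        excess-≤ : ∀ v → excess c′ v ≤ excess c v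
        excess-≤ v with inc v g in vg | deg≡ v
        ... | false | eq = ∸-monoˡ-≤ 5 (≤-trans (m≤m+n _ ⟦ inc v f ⟧) (≤-reflexive (trans eq (+-identityʳ _))))
        -- An end of `g` has degree at most 4 in `c`, hence at most 5 in `c′`, and its excess stays
        -- 0.
        ... | true  | eq = ≤-trans (≤-reflexive (m≤n⇒m∸n≡0 deg≤5)) z≤n
          where
          deg≤4 : deg c v ≤ 4
          deg≤4 with inc-ends {v} {g} vg
          ... | inj₁ refl = d₁
          ... | inj₂ refl = d₂
          deg≤5 : deg c′ v ≤ 5
          deg≤5 = ≤-trans (m≤m+n _ ⟦ inc v f ⟧) (≤-trans (≤-reflexive eq) (+-monoˡ-≤ 1 deg≤4))
        variant′ : Variant S c′
        variant′ = record
          { rearranged = rearranged′ ; packing = packing′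
          ; small = ≤-trans (sum-mono excess-≤) (Variant.small var) }
        deg-z : deg c z ≡ suc (deg c′ z)
        deg-z = begin
          deg c z                  ≡⟨ +-identityʳ _ ⟨
          deg c z + 0              ≡⟨ cong (λ x → deg c z + ⟦ x ⟧) (inc-miss {z} {g} (≢z s₁) (≢z s₂)) ⟨
          deg c z + ⟦ inc z g ⟧    ≡⟨ deg≡ z ⟨
          deg c′ z + ⟦ inc z f ⟧   ≡⟨ cong (λ x → deg c′ z + ⟦ x ⟧) zf ⟩
          deg c′ z + 1             ≡⟨ +-comm _ 1 ⟩
          suc (deg c′ z)           ∎
          where open ≡-Reasoning
        deg-z≥5 : 5 ≤ deg c′ z
        -- Either `z` has its degree from `b`, at least 6, in `c` and loses one, or `c′` is itself a
        -- variant for `S`, to which the hypothesis on `z` applies.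
        deg-z≥5 = Sum.[ (λ h → +-cancelˡ-≤ 1 _ _ (≤-trans h (≤-reflexive (trans (sym (variant-deg var (⊞-self S z))) deg-z))))
                      , (λ h → h c′ variant′) ] heavy
        smaller : total c′ < total c
        -- Degree at least 5 after the loss ensures that the truncated difference really drops.
        smaller = sum-mono-< excess-≤ z
          (≤-reflexive (trans (sym (+-∸-assoc 1 deg-z≥5)) (cong (_∸ 5) (sym deg-z))))

      contradictory : ¬ Linked (S ⊞ z) (p₁ g) (p₂ g) → ⊥
      contradictory nl = decide-all Leftover λ leftover? → search leftover? (any? (λ f → leftover? f ×-dec (inc z f Bool.≟ true)))
        where
        search : (leftover? : ∀ f → Dec (Leftover f)) → Dec (∃ λ f → Leftover f × inc z f ≡ true) → ⊥
        search leftover? (yes (f , (c′ , r) , zf)) = improve c′ f r zf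
        -- The circuit is tight for `c`, but a link must be tight for `b`. The two agree between
        -- classes of `S ⊞ z`, so the circuit enlarged by all the classes it meets is tight for `b`.
        search leftover? (no none) = decide-all Near λ near? → nl (record
          { W      = λ v → does (near? v)
          ; avoids = λ v h → linked-right (proj₂ (proj₂ (does⇒ (near? v) h)))
          ; tight  = λ i {u} {v} hu hv → weaken (λ e (t , p , q) → t , dec-true (near? (p₁ e)) p , dec-true (near? (p₂ e)) q)
                       (near-path i (does⇒ (near? u) hu) (does⇒ (near? v) hv))
          ; u∈W    = dec-true (near? _) (on-circuit done)
          ; v∈W    = dec-true (near? _) (on-circuit (edge g (c , start) (joins g))) })
          where
          Near : Vertex G → Set
          Near v = ∃ λ w → Circuit leftover? w × Linked (S ⊞ z) w v
          outside-S : ∀ {v} → Circuit leftover? v → (S ⊞ z) v ≡ false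
          outside-S {v} p = trans (⊞-other S v≢z) (linked-right (circuit⊆W leftover? p))
            where
            v≢z : v ≢ z
            v≢z refl = circuit-avoids leftover? z (≢z s₁) (λ f k → ¬true⇒false (λ h → none (f , k , h))) p
          on-circuit : ∀ {v} → Circuit leftover? v → Near v
          on-circuit p = _ , p , linked-refl (outside-S p)
          class-path : ∀ i {u v} → Circuit leftover? u → Linked (S ⊞ z) u v → Path (λ e → Tree b i e × Both Near e) u v
          class-path i k l = weaken (λ _ (t , p , q) → t , (_ , k , p) , (_ , k , q)) (linked-path l i)
          circuit-path : ∀ i e → Tree c i e × Both (Circuit leftover?) e → Path (λ e → Tree b i e × Both Near e) (p₁ e) (p₂ e)
          circuit-path i e (t , p , q) with Variant.agree var e
          ... | inj₁ eq = edge e (trans (cong (has i) (sym eq)) t , on-circuit p , on-circuit q) (joins e)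
          ... | inj₂ l  = class-path i p l
          near-path : TightIn b Near
          near-path i (_ , ku , lu) (_ , kv , lv) =
            reverse (class-path i ku lu) ⁀ bind-ends (circuit-path i) (circuit-tight leftover? i ku kv) ⁀ class-path i kv lv

    -- If the ends of `g` are linked outside `S`, an exchange in their class decides; otherwise
    -- `Blocked S` applies, as a variant for `S ⊞ z` is one for `S`. The first alternative on `z`
    -- admits `u`, the second all later vertices.
    blocked-step : ∀ S z → Blocked S → S z ≡ false → (6 ≤ deg b z ⊎ (∀ c → Variant S c → 5 ≤ deg c z)) → Blocked (S ⊞ z)
    blocked-step S z blocked sz heavy c var g free s₁ s₂ nl d₁ d₂ = em λ
      { (yes l) → Step.contradictory S z sz heavy c var g free s₁ s₂ d₁ d₂ l nl
      ; (no ¬l) → blocked c (variant-anti (λ _ → ∨-trueˡ) var) g free (old s₁) (old s₂) ¬l d₁ d₂ }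
      where
      old : ∀ {x} → (S ⊞ z) x ≡ false → S x ≡ false
      old h = ¬true⇒false (λ t → true≢false (∨-trueˡ t) h)

    -- The two mixtures of c and c′ together use each edge as often as c and c′ do; as neither can have fewer edges or a
    -- smaller total than the optimum, both are optimal.
    module Mix (S : Vertex G → Bool) (x : Vertex G) (near? : ∀ v → Dec (Linked S x v)) where

      near : Vertex G → Bool
      near v = does (near? v)

      mix : Colouring → Colouring → Colouring
      mix c c′ e = if inside near e then c e else c′ e

      mix-near : ∀ c c′ {e} → inside near e ≡ true → mix c c′ e ≡ c e
      mix-near c c′ h = cong (λ t → if t then _ else _) h

      mix-far : ∀ c c′ {e} → inside near e ≡ false → mix c c′ e ≡ c′ e
      mix-far c c′ h = cong (λ t → if t then _ else _) h

      mix-rearranged : ∀ {c c′} → Rearranged S c → Rearranged S c′ → Rearranged S (mix c c′)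
      mix-rearranged {c} {c′} r r′ = record { agree = agree ; tight = tight }
        where
        agree : ∀ e → mix c c′ e ≡ b e ⊎ Linked S (p₁ e) (p₂ e)
        agree e with inside near e
        ... | true  = Rearranged.agree r e
        ... | false = Rearranged.agree r′ e
        tight : ∀ i {u v} → Linked S u v → Path (λ e → Tree (mix c c′) i e × Both (Linked S u) e) u v
        tight i {u} l with near? u
        ... | yes xu = weaken use (Rearranged.tight r i l)
          where
          use : ∀ e → Tree c i e × Both (Linked S u) e → Tree (mix c c′) i e × Both (Linked S u) e
          use e (t , p , q) = trans (cong (has i) (mix-near c c′ (true-∧ (dec-true (near? (p₁ e)) (linked-trans xu p))
                                                                  (dec-true (near? (p₂ e)) (linked-trans xu q))))) t , p , q
        ... | no ¬xu = weaken use (Rearranged.tight r′ i l)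
          where
          use : ∀ e → Tree c′ i e × Both (Linked S u) e → Tree (mix c c′) i e × Both (Linked S u) e
          use e (t , p , q) = trans (cong (has i) (mix-far c c′ (¬true⇒false λ h →
            ¬xu (linked-trans (does⇒ (near? (p₁ e)) (proj₁ (∧-true h))) (linked-sym p))))) t , p , q

      private
        swap-+ : ∀ {A : Set} (t : Bool) (φ : A → ℕ) (a a′ : A) →
                 φ (if t then a else a′) + φ (if t then a′ else a) ≡ φ a + φ a′
        swap-+ true  φ a a′ = refl
        swap-+ false φ a a′ = +-comm (φ a′) (φ a)

        -- Two numbers that are at least `l` and add up to at most `2 * l` both equal `l`. Applied
        -- with `l` the number of vertices, for edge counts, and with `l` the optimal total.
        squeeze : ∀ {l k k′ N N′} → l ≤ k → l ≤ k′ → k + k′ ≡ N + N′ → N ≤ l → N′ ≤ l → k ≤ l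
        squeeze {l} {k} {k′} {N} {N′} lk lk′ eq nl nl′ = +-cancelʳ-≤ l k l (begin
          k + l   ≤⟨ +-monoʳ-≤ k lk′ ⟩
          k + k′  ≡⟨ eq ⟩
          N + N′  ≤⟨ +-mono-≤ nl nl′ ⟩
          l + l   ∎)
          where open ≤-Reasoning

      mix-packing : ∀ {c c′} → Variant S c → Variant S c′ → Packing (mix c c′)
      mix-packing {c} {c′} r r′ = record
        { spans = spans r r′
        ; size  = λ i → ≤-antisym
            (squeeze (spans⇒≤ _ (spans r r′ i) x) (spans⇒≤ _ (spans r′ r i) x)
              (trans (cong suc (+-suc _ _)) (trans (cong (λ t → suc (suc t)) (sizes i)) (sym (cong suc (+-suc _ _)))))
              (≤-reflexive (Packing.size (Variant.packing r) i)) (≤-reflexive (Packing.size (Variant.packing r′) i)))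
            (spans⇒≤ _ (spans r r′ i) x) }
        where
        spans : ∀ {c c′} → Variant S c → Variant S c′ → ∀ i → Spans (λ e → has i (mix c c′ e))
        spans r r′ = rearranged-spans (mix-rearranged (Variant.rearranged r) (Variant.rearranged r′))
        sizes : ∀ i → # (λ e → has i (mix c c′ e)) + # (λ e → has i (mix c′ c e)) ≡
                      # (λ e → has i (c e)) + # (λ e → has i (c′ e))
        sizes i = #-+ (λ e → swap-+ (inside near e) (λ t → ⟦ has i t ⟧) (c e) (c′ e))

      -- An edge with just one end in the class of `x` is coloured as in `b` by both `c` and `c′`,
      -- so it does not matter which of them is copied there.
      mix-deg : ∀ {c c′} → Rearranged S c → Rearranged S c′ → ∀ v →
                deg (mix c c′) v ≡ (if near v then deg c v else deg c′ v)
      mix-deg {c} {c′} r r′ v with near? v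
      ... | yes xv = #-cong same
        where
        fixed : ∀ {c} → Rearranged S c → ∀ e → inside near e ≡ false → inc v e ≡ true → c e ≡ b e
        fixed r e far h with Rearranged.agree r e
        ... | inj₁ q = q
        ... | inj₂ l = ⊥-elim (true≢false (true-∧ (dec-true (near? (p₁ e)) (proj₁ ends-near)) (dec-true (near? (p₂ e)) (proj₂ ends-near))) far)
          where
          ends-near : Both (Linked S x) e
          ends-near with inc-ends {v} {e} h
          ... | inj₁ refl = xv , linked-trans xv l
          ... | inj₂ refl = linked-trans xv (linked-sym l) , xv
        same : ∀ e → is-just (mix c c′ e) ∧ inc v e ≡ is-just (c e) ∧ inc v e
        same e with inside near e in far | inc v e in at-v
        ... | true  | _     = refl
        ... | false | true  = cong (λ t → is-just t ∧ true) (trans (fixed r′ e far at-v) (sym (fixed r e far at-v)))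
        ... | false | false = trans (∧-zeroʳ (is-just (c′ e))) (sym (∧-zeroʳ (is-just (c e))))
      ... | no ¬xv = #-cong same
        where
        same : ∀ e → is-just (mix c c′ e) ∧ inc v e ≡ is-just (c′ e) ∧ inc v e
        same e with inside near e in close | inc v e in at-v
        ... | false | _     = refl
        ... | true  | false = trans (∧-zeroʳ (is-just (c e))) (sym (∧-zeroʳ (is-just (c′ e))))
        ... | true  | true with inc-ends {v} {e} at-v
        ...   | inj₁ refl = ⊥-elim (¬xv (does⇒ (near? (p₁ e)) (proj₁ (∧-true close))))
        ...   | inj₂ refl = ⊥-elim (¬xv (does⇒ (near? (p₂ e)) (proj₂ (∧-true close))))

      mix-variant : ∀ {c c′} → Variant S c → Variant S c′ → Variant S (mix c c′)
      mix-variant {c} {c′} r r′ = record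
        { rearranged = mix-rearranged R.rearranged R′.rearranged
        ; packing = mix-packing r r′
        ; small = squeeze (minimal _ (mix-packing r r′)) (minimal _ (mix-packing r′ r)) totals R.small R′.small }
        where
        module R = Variant r
        module R′ = Variant r′
        totals : total (mix c c′) + total (mix c′ c) ≡ total c + total c′
        totals = trans (sym (∑-distrib-+ (excess (mix c c′)) (excess (mix c′ c))))
          (trans (sum-cong-≗ pointwise) (∑-distrib-+ (excess c) (excess c′)))
          where
          pointwise : ∀ v → excess (mix c c′) v + excess (mix c′ c) v ≡ excess c v + excess c′ v
          pointwise v rewrite mix-deg R.rearranged R′.rearranged v | mix-deg R′.rearranged R.rearranged v =
            swap-+ (near v) (_∸ 5) (deg c v) (deg c′ v)

    Light : (Vertex G → Bool) → Vertex G → Set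
    Light S v = ∃ λ c → Variant S c × deg c v ≤ 4

    -- The ends of a crossing edge may be light in different variants only; as they lie in different
    -- classes, a mixture makes both light at once. Were the edge uncoloured, it would contradict
    -- `Blocked`.
    crossing-coloured : ∀ S → Blocked S → (∀ v → S v ≡ false → ¬ ¬ Light S v) →
                        ∀ g → S (p₁ g) ≡ false → S (p₂ g) ≡ false → ¬ Linked S (p₁ g) (p₂ g) → is-just (b g) ≡ true
    crossing-coloured S blocked light g s₁ s₂ nl with b g in free
    ... | just _  = refl
    ... | nothing = ⊥-elim (light _ s₁ λ (c , r , d) → light _ s₂ λ (c′ , r′ , d′) →
        decide-all (Linked S (p₁ g)) λ near? → clash c r d c′ r′ d′ near?)
      where
      clash : ∀ c → Variant S c → deg c (p₁ g) ≤ 4 → ∀ c′ → Variant S c′ → deg c′ (p₂ g) ≤ 4 →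
              (∀ v → Dec (Linked S (p₁ g) v)) → ⊥
      clash c r d c′ r′ d′ near? = blocked (mix c c′) (mix-variant r r′) g uncoloured s₁ s₂ nl
        (subst (_≤ 4) (sym (trans (mix-deg R.rearranged R′.rearranged (p₁ g))
          (cong (λ t → if t then _ else _) (dec-true (near? (p₁ g)) (linked-refl s₁))))) d)
        (subst (_≤ 4) (sym (trans (mix-deg R.rearranged R′.rearranged (p₂ g))
          (cong (λ t → if t then _ else _) (dec-false (near? (p₂ g)) nl)))) d′)
        where
        open Mix S (p₁ g) near?
        module R = Variant r
        module R′ = Variant r′
        uncoloured : mix c c′ g ≡ nothing
        uncoloured with Variant.agree (mix-variant r r′) g
        ... | inj₁ q = trans q free
        ... | inj₂ l = ⊥-elim (nl l)

    record Barrier (u : Vertex G) : Set where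
      field
        S        : Vertex G → Bool
        u∈S      : S u ≡ true
        heavy    : ∀ z → S z ≡ true → 5 ≤ deg b z
        crossing : ∀ g → S (p₁ g) ≡ false → S (p₂ g) ≡ false → ¬ Linked S (p₁ g) (p₂ g) → is-just (b g) ≡ true

    -- From `u` on, `S` absorbs vertices of degree at least 5 in every variant until none is left;
    -- then each vertex outside has degree at most 4 in some variant. `k` bounds the number of
    -- vertices still to be absorbed.
    barrier : ∀ u → 6 ≤ deg b u → ¬ ¬ Barrier u
    barrier u d none = grow (n G) ((λ _ → false) ⊞ u) (⊞-self (λ _ → false) u)
        (λ z h → subst (λ z → 5 ≤ deg b z) (sym (==⇒≡ {i = z} h)) (≤-trans (n≤1+n 5) d))
        (blocked-step (λ _ → false) u blocked-empty refl (inj₁ d)) (m≤n+m _ _)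
      where
      grow : ∀ k S → S u ≡ true → (∀ z → S z ≡ true → 5 ≤ deg b z) → Blocked S → n G ≤ # S + k → ⊥
      extend : ∀ k S → S u ≡ true → (∀ z → S z ≡ true → 5 ≤ deg b z) → Blocked S → n G ≤ # S + k →
               ∀ z → S z ≡ false → (∀ c → Variant S c → 5 ≤ deg c z) → ⊥
      grow k S us heavy blocked fuel = em {P = ∃ λ z → S z ≡ false × (∀ c → Variant S c → 5 ≤ deg c z)} λ
        { (yes (z , sz , h)) → extend k S us heavy blocked fuel z sz h
        ; (no maximal) → none (record
            { S = S ; u∈S = us ; heavy = heavy
            ; crossing = crossing-coloured S blocked λ v sv dark → maximal (v , sv , λ c r →
                ≰⇒> (λ le → dark (c , r , le))) }) }
      extend zero S us heavy blocked fuel z sz h = <-irrefl refl (begin-strict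
        # S                             <⟨ #-mono-< {f = S} {g = λ _ → true} (λ _ _ → refl) z sz refl ⟩
        # (λ (_ : Vertex G) → true)      ≡⟨ #-all (n G) ⟩
        n G                             ≤⟨ fuel ⟩
        # S + 0                         ≡⟨ +-identityʳ _ ⟩
        # S                             ∎)
        where open ≤-Reasoning
      extend (suc k) S us heavy blocked fuel z sz h =
        grow k (S ⊞ z) (∨-trueˡ us) heavy′ (blocked-step S z blocked sz (inj₂ h))
          (≤-trans fuel (≤-reflexive (trans (+-suc (# S) k) (cong (_+ k) (sym (#-⊞ S sz))))))
        where
        heavy′ : ∀ w → (S ⊞ z) w ≡ true → 5 ≤ deg b w
        heavy′ w hw with ∨-true {S w} hw
        ... | inj₁ sw = heavy w sw
        ... | inj₂ wz with refl ← ==⇒≡ {i = w} wz = h b variant-base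

-- Deleting few vertices to separate many

module Separation (G : Graph) where

  open Walks G
  open Swaps G
  open Barriers G

  Joins-unique : ∀ {e u a b} → Joins G e u a → Joins G e u b → a ≡ b
  Joins-unique         (inj₁ (refl , refl)) (inj₁ (_ , refl)) = refl
  Joins-unique {e = e} (inj₁ (refl , refl)) (inj₂ (_ , r))    = ⊥-elim (noLoop G e (sym r))
  Joins-unique {e = e} (inj₂ (refl , refl)) (inj₁ (r , _))    = ⊥-elim (noLoop G e r)
  Joins-unique         (inj₂ (refl , refl)) (inj₂ (refl , _)) = refl

  Joins-≢ : ∀ {e u v} → Joins G e u v → u ≢ v
  Joins-≢ {e} (inj₁ (refl , refl)) q = noLoop G e q
  Joins-≢ {e} (inj₂ (refl , refl)) q = noLoop G e (sym q)

  Joins-inc : ∀ {e u v} → Joins G e u v → inc u e ≡ true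
  Joins-inc {e} {u} (inj₁ (refl , refl)) = ∨-trueˡ (==-refl u)
  Joins-inc {e} {u} (inj₂ (refl , refl)) = ∨-trueʳ {p₁ e == u} (==-refl u)

  inc-Joins : ∀ {e u} → inc u e ≡ true → ∃ λ v → Joins G e u v
  inc-Joins {e} {u} h with inc-ends {u} {e} h
  ... | inj₁ q = p₂ e , inj₁ (q , refl)
  ... | inj₂ q = p₁ e , inj₂ (refl , q)

  at : (Vertex G → Bool) → Vertex G → Edge G → Bool
  at A v e = inside A e ∧ inc v e

  degIn : (Vertex G → Bool) → Vertex G → ℕ
  degIn A v = # (at A v)

  ─-true : ∀ (A : Vertex G → Bool) {x v} → A v ≡ true → v ≢ x → (A ─ x) v ≡ true
  ─-true A av v≢x = trans (─-other A v≢x) av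

  inside-─ : ∀ A v e → ⟦ inside A e ⟧ ≡ ⟦ inside (A ─ v) e ⟧ + ⟦ at A v e ⟧
  inside-─ A v e = table (A (p₁ e)) (A (p₂ e)) (p₁ e == v) (p₂ e == v)
    where
    table : ∀ a b x y → ⟦ a ∧ b ⟧ ≡ ⟦ (a ∧ not x) ∧ (b ∧ not y) ⟧ + ⟦ (a ∧ b) ∧ (x ∨ y) ⟧
    table false _     _     _     = refl
    table true  false true  _     = refl
    table true  false false _     = refl
    table true  true  true  _     = refl
    table true  true  false true  = refl
    table true  true  false false = refl

  edges-─ : ∀ A v → # (inside A) ≡ # (inside (A ─ v)) + degIn A v
  edges-─ A v = #-split (inside-─ A v)

  at-─ : ∀ A {x v e} → at (A ─ x) v e ≡ true → at A v e ≡ true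
  at-─ A {x} {v} {e} h with ∧-true {inside (A ─ x) e} h
  ... | ins , i = true-∧ (inside-mono {A ─ x} {A} {e} (λ w q → proj₁ (─⁻ A {x} {w} q)) ins) i

  at-─-gone : ∀ A {x v e} → inc x e ≡ true → at (A ─ x) v e ≡ false
  at-─-gone A {x} {v} {e} h = ¬true⇒false λ q → gone (inc-Joins {e} {x} h) (proj₁ (∧-true {inside (A ─ x) e} q))
    where
    gone : (∃ λ w → Joins G e x w) → inside (A ─ x) e ≡ true → ⊥
    gone (w , j) ins = true≢false (proj₁ (inside-joins (A ─ x) j ins)) (─-self A x)

  at-intro : ∀ A {e u v} → Joins G e u v → A u ≡ true → A v ≡ true → at A u e ≡ true
  at-intro A j au av = true-∧ (joins-inside A j au av) (Joins-inc j)

  neighbour : ∀ A {v e} → at A v e ≡ true → ∃ λ a → Joins G e v a × A a ≡ true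
  neighbour A {v} {e} h with ∧-true {inside A e} h
  ... | ins , i with inc-Joins {e} {v} i
  ...   | a , j = a , j , proj₂ (inside-joins A j ins)

  degIn-anti : ∀ A {x v} → degIn (A ─ x) v ≤ degIn A v
  degIn-anti A = #-mono (λ e → at-─ A {e = e})

  degIn-drop : ∀ A {x v e} → Joins G e v x → A v ≡ true → A x ≡ true → degIn (A ─ x) v < degIn A v
  degIn-drop A {e = e} j av ax = #-mono-< (λ e → at-─ A {e = e}) e (at-─-gone A (Joins-inc (flip j))) (at-intro A j av ax)

  -- k pairwise separated vertices of A after deleting the vertices of A outside Z, with
  -- 4∣A∣ + 2∣A ∖ Z∣ + s ≤ 7k + 2∣E(A)∣, where ∣A ∖ Z∣ is written as ∣A∣ − ∣Z∣.
  record Separated (A : Vertex G → Bool) (s : ℕ) : Set where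
    field
      Z         : Vertex G → Bool
      Z⊆A       : ∀ v → Z v ≡ true → A v ≡ true
      k         : ℕ
      y         : Fin k → Vertex G
      y∈Z       : ∀ i → Z (y i) ≡ true
      separated : ∀ i j → Path (λ e → inside Z e ≡ true) (y i) (y j) → i ≡ j
      bound     : 6 * # A + s ≤ 7 * k + 2 * # (inside A) + 2 * # Z

  relax : ∀ {A s s′} → s′ ≤ s → Separated A s → Separated A s′
  relax le r = record { Separated r ; bound = ≤-trans (+-monoʳ-≤ _ le) (Separated.bound r) }

  -- A deleted vertex adds 6 on the left and twice its degree on the right: free at degree 3, a loss
  -- of 2 at degree 2.
  delete : ∀ A {v s s′ t} → A v ≡ true → t ≤ degIn A v → 6 + s′ ≤ s + 2 * t → Separated (A ─ v) s → Separated A s′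
  delete A {v} {s} {s′} {t} av t≤ le r = record
    { Z = Z ; Z⊆A = λ w h → proj₁ (─⁻ A {v} {w} (Z⊆A w h)) ; k = k ; y = y ; y∈Z = y∈Z ; separated = separated
    ; bound = bound′ }
    where
    open Separated r
    bound′ : 6 * # A + s′ ≤ 7 * k + 2 * # (inside A) + 2 * # Z
    bound′ rewrite #-─ A av | edges-─ A v =
      cancel s (l≡ (# (A ─ v)) s s′) (r≡ (# (inside (A ─ v))) (degIn A v) (# Z) k s)
        (+-mono-≤ bound (≤-trans le (+-monoʳ-≤ s (*-monoʳ-≤ 2 t≤))))
      where
      l≡ : ∀ a s s′ → 6 * suc a + s′ + s ≡ 6 * a + s + (6 + s′)
      l≡ = solve-∀
      r≡ : ∀ e d z k s → 7 * k + 2 * (e + d) + 2 * z + s ≡ 7 * k + 2 * e + 2 * z + (s + 2 * d)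
      r≡ = solve-∀

  -- Putting such a vertex back joins no two vertices that were separated before.
  Simplicial : (Vertex G → Bool) → Vertex G → Set
  Simplicial A v = ∀ {e f a b} → Joins G e v a → Joins G f v b → A a ≡ true → A b ≡ true → a ≡ b ⊎ ∃ λ h → Joins G h a b

  module Shortcut (A Z : Vertex G → Bool) (v : Vertex G) (Z⊆A : ∀ w → Z w ≡ true → (A ─ v) w ≡ true)
                  (simplicial : Simplicial A v) where

    old : ∀ {w} → (Z ⊞ v) w ≡ true → w ≢ v → Z w ≡ true
    old h w≢v = trans (sym (⊞-other Z w≢v)) h

    in-A : ∀ {w} → Z w ≡ true → A w ≡ true
    in-A {w} h = proj₁ (─⁻ A {v} {w} (Z⊆A w h))

    step-to : ∀ {a x} → Z a ≡ true → Z x ≡ true → a ≡ x ⊎ (∃ λ h → Joins G h a x) → Path (λ e → inside Z e ≡ true) a x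
    step-to za zx (inj₁ refl)    = done
    step-to za zx (inj₂ (h , j)) = edge h (joins-inside Z j za zx) j

    -- Two claims in one induction: a walk from `u` other than `v` can bypass `v`, and for a walk
    -- from `v` itself the bypass may begin at any neighbour of `v` in `Z`.
    shortcut : ∀ {u w} → Path (λ e → inside (Z ⊞ v) e ≡ true) u w → w ≢ v →
               (u ≢ v → Path (λ e → inside Z e ≡ true) u w) ×
               (∀ {e a} → Joins G e v a → Z a ≡ true → u ≡ v → Path (λ e → inside Z e ≡ true) a w)
    shortcut done w≢v = (λ _ → done) , (λ _ _ u≡v → ⊥-elim (w≢v u≡v))
    shortcut {u} (via {w = x} e pe j p) w≢v with shortcut p w≢v | inside-joins (Z ⊞ v) j pe
    ... | direct , detour | zu , zx = from-u , from-v
      where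
      from-u : u ≢ v → Path (λ e → inside Z e ≡ true) u _
      from-u u≢v = go (x ≟ v)
        where
        go : Dec (x ≡ v) → Path (λ e → inside Z e ≡ true) u _
        go (yes x≡v) = detour (subst (λ v → Joins G e v u) x≡v (flip j)) (old zu u≢v) x≡v
        go (no x≢v)  = via e (joins-inside Z j (old zu u≢v) (old zx x≢v)) j (direct x≢v)
      from-v : ∀ {e a} → Joins G e v a → Z a ≡ true → u ≡ v → Path (λ e → inside Z e ≡ true) a _
      from-v j′ za refl = step-to za zx′ (simplicial j′ j (in-A za) (in-A zx′)) ⁀ direct x≢v
        where
        x≢v : x ≢ v
        x≢v q = Joins-≢ j (sym q)
        zx′ : Z x ≡ true
        zx′ = old zx x≢v

    separate : ∀ {u w} → Z u ≡ true → Z w ≡ true → Path (λ e → inside (Z ⊞ v) e ≡ true) u w → Path (λ e → inside Z e ≡ true) u w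
    separate zu zw p = proj₁ (shortcut p (≢v zw)) (≢v zu)
      where
      ≢v : ∀ {w} → Z w ≡ true → w ≢ v
      ≢v {w} zw = proj₂ (─⁻ A {v} {w} (Z⊆A w zw))

  ⊞-⊆ : ∀ A Z {v : Vertex G} → A v ≡ true → (∀ w → Z w ≡ true → (A ─ v) w ≡ true) → ∀ w → (Z ⊞ v) w ≡ true → A w ≡ true
  ⊞-⊆ A Z {v} av Z⊆A w h with ∨-true {Z w} h
  ... | inj₁ zw = proj₁ (─⁻ A {v} {w} (Z⊆A w zw))
  ... | inj₂ wv with refl ← ==⇒≡ {i = w} wv = av

  not-in : ∀ A (Z : Vertex G → Bool) {v} → (∀ w → Z w ≡ true → (A ─ v) w ≡ true) → Z v ≡ false
  not-in A Z {v} Z⊆A = ¬true⇒false λ h → true≢false (Z⊆A v h) (─-self A v)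

  -- A vertex that is kept without adding a component loses 4 instead of 6, against twice its
  -- degree: free at degree 2.
  absorb : ∀ A {v s s′ t} → A v ≡ true → t ≤ degIn A v → 4 + s′ ≤ s + 2 * t → Simplicial A v → Separated (A ─ v) s → Separated A s′
  absorb A {v} {s} {s′} {t} av t≤ le simplicial r = record
    { Z = Z ⊞ v ; Z⊆A = ⊞-⊆ A Z av Z⊆A ; k = k ; y = y ; y∈Z = λ i → ∨-trueˡ (y∈Z i)
    ; separated = λ i j p → separated i j (separate (y∈Z i) (y∈Z j) p)
    ; bound = bound′ }
    where
    open Separated r
    open Shortcut A Z v Z⊆A simplicial
    bound′ : 6 * # A + s′ ≤ 7 * k + 2 * # (inside A) + 2 * # (Z ⊞ v)
    bound′ rewrite #-─ A av | edges-─ A v | #-⊞ Z (not-in A Z Z⊆A) =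
      cancel (2 + s) (l≡ (# (A ─ v)) s s′) (r≡ (# (inside (A ─ v))) (degIn A v) (# Z) k s)
        (+-mono-≤ bound (+-monoʳ-≤ 4 (≤-trans le (+-monoʳ-≤ s (*-monoʳ-≤ 2 t≤)))))
      where
      l≡ : ∀ a s s′ → 6 * suc a + s′ + (2 + s) ≡ 6 * a + s + (4 + (4 + s′))
      l≡ = solve-∀
      r≡ : ∀ e d z k s → 7 * k + 2 * (e + d) + 2 * suc z + (2 + s) ≡ 7 * k + 2 * e + 2 * z + (4 + (s + 2 * d))
      r≡ = solve-∀

  -- A new component brings 7, and 2 more as `v` is not deleted, against 6 for the vertex: a gain of
  -- 3.
  isolate : ∀ A {v s} → A v ≡ true → degIn A v ≤ 0 → Separated (A ─ v) s → Separated A (3 + s)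
  isolate A {v} {s} av isolated r = record
    { Z = Z ⊞ v ; Z⊆A = ⊞-⊆ A Z av Z⊆A ; k = suc k ; y = y′ ; y∈Z = y′∈Z ; separated = separated′ ; bound = bound′ }
    where
    open Separated r
    no-edge : ∀ {e a} → Joins G e v a → A a ≡ true → ⊥
    no-edge {e} j aa = <-irrefl refl (<-≤-trans (#-pos e (at-intro A j av aa)) isolated)
    open Shortcut A Z v Z⊆A (λ j _ aa _ → ⊥-elim (no-edge j aa))
    y′ : Fin (suc k) → Vertex G
    y′ zero    = v
    y′ (suc i) = y i
    y′∈Z : ∀ i → (Z ⊞ v) (y′ i) ≡ true
    y′∈Z zero    = ⊞-self Z v
    y′∈Z (suc i) = ∨-trueˡ (y∈Z i)
    alone : ∀ {w} → Z w ≡ true → Path (λ e → inside (Z ⊞ v) e ≡ true) v w → ⊥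
    alone zw done            = true≢false zw (not-in A Z Z⊆A)
    alone zw (via e pe j p)  = no-edge j (⊞-⊆ A Z av Z⊆A _ (proj₂ (inside-joins (Z ⊞ v) j pe)))
    separated′ : ∀ i j → Path (λ e → inside (Z ⊞ v) e ≡ true) (y′ i) (y′ j) → i ≡ j
    separated′ zero    zero    p = refl
    separated′ zero    (suc j) p = ⊥-elim (alone (y∈Z j) p)
    separated′ (suc i) zero    p = ⊥-elim (alone (y∈Z i) (reverse p))
    separated′ (suc i) (suc j) p = cong suc (separated i j (separate (y∈Z i) (y∈Z j) p))
    bound′ : 6 * # A + (3 + s) ≤ 7 * suc k + 2 * # (inside A) + 2 * # (Z ⊞ v)
    bound′ rewrite #-─ A av | edges-─ A v | #-⊞ Z (not-in A Z Z⊆A) | n≤0⇒n≡0 isolated =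
      subst₂ _≤_ (l≡ (# (A ─ v)) s) (r≡ (# (inside (A ─ v))) (# Z) k) (+-monoˡ-≤ 9 bound)
      where
      l≡ : ∀ a s → 6 * a + s + 9 ≡ 6 * suc a + (3 + s)
      l≡ = solve-∀
      r≡ : ∀ e z k → 7 * k + 2 * e + 2 * z + 9 ≡ 7 * suc k + 2 * (e + 0) + 2 * suc z
      r≡ = solve-∀

  -- An isolated vertex gains 3. Otherwise let `b` be the neighbour of `v`: deleting `b` at degree
  -- at least 2 loses at most 2 and isolates `v`; at degree 1, absorbing `v` loses 2 and isolates
  -- `b`. Either way at least 1 remains.
  low-degree : ∀ A v → A v ≡ true → degIn A v ≤ 1 → (∀ A′ → # A′ < # A → Separated A′ 0) → Separated A 1
  low-degree A v av d≤1 ih with any? (λ e → at A v e Bool.≟ true)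
  ... | no none = relax (s≤s z≤n) (isolate A av (≤-reflexive (#-none λ e → ¬true⇒false λ h → none (e , h)))
                                     (ih (A ─ v) (≤-reflexive (sym (#-─ A av)))))
  ... | yes (e , h) with neighbour A h
  ...   | b , j , ab = by-degree (2 ≤? degIn A b)
    where
    v≢b : v ≢ b
    v≢b = Joins-≢ j
    smaller : ∀ {x} → A x ≡ true → ∀ {x′} → (A ─ x) x′ ≡ true → # (A ─ x ─ x′) < # A
    smaller {x} ax ax′ = ≤-trans (≤-reflexive (sym (#-─ (A ─ x) ax′))) (≤-trans (n≤1+n _) (≤-reflexive (sym (#-─ A ax))))
    by-degree : Dec (2 ≤ degIn A b) → Separated A 1
    by-degree (yes 2≤d) = delete A ab 2≤d ≤-refl
      (isolate (A ─ b) (─-true A av v≢b) (≤-pred (≤-trans (degIn-drop A j av ab) d≤1)) (ih _ (smaller ab (─-true A av v≢b))))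
    by-degree (no 2≰d) = absorb A av (#-pos e h) ≤-refl one-edge
      (isolate (A ─ v) (─-true A ab (v≢b ∘ sym)) (≤-pred (≤-trans (degIn-drop A (flip j) ab av) (≤-pred (≰⇒> 2≰d))))
        (ih _ (smaller av (─-true A ab (v≢b ∘ sym)))))
      where
      only : ∀ {f a} → Joins G f v a → A a ≡ true → a ≡ b
      only {f} jf aa with f ≟ e
      ... | yes refl = Joins-unique jf j
      ... | no  f≢e  = ⊥-elim (1+n≰n (≤-trans (m≤m+n 2 _) (≤-trans
                          (#-two (at A v) (λ _ → false) (λ _ ()) f≢e (at-intro A jf av aa) h refl refl) d≤1)))
      one-edge : Simplicial A v
      one-edge jf jg aa ab′ = inj₁ (trans (only jf aa) (sym (only jg ab′)))

  second-edge : ∀ A v → 2 ≤ degIn A v → ∀ {e} → at A v e ≡ true → ∃ λ f → f ≢ e × at A v f ≡ true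
  second-edge A v 2≤d {e} h with #-witness {f = at A v ─ e} (≤-pred (≤-trans 2≤d (≤-reflexive (#-─ (at A v) h))))
  ... | f , q = f , proj₂ (─⁻ (at A v) {e} {f} q) , proj₁ (─⁻ (at A v) {e} {f} q)

  -- Deleting a vertex of degree at least 3 costs nothing, and vertices of degree at most 1 leave slack.  In the remaining
  -- 2-regular case, deleting both neighbours of a vertex isolates it and leaves a vertex of degree at most 1.
  separable : ∀ A → Separated A 0
  separable A = induct (suc (# A)) A ≤-refl
    where
    induct : ∀ k A → # A < k → Separated A 0
    induct (suc k) A (s≤s A≤k) with any? (λ v → A v Bool.≟ true)
    ... | no empty = record
      { Z = λ _ → false ; Z⊆A = λ _ () ; k = 0 ; y = λ () ; y∈Z = λ () ; separated = λ ()
      ; bound = ≤-trans (≤-reflexive (trans (+-identityʳ _) (cong (6 *_) (#-none λ v → ¬true⇒false λ h → empty (v , h))))) z≤n }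
    ... | yes (v₀ , av₀) with any? (λ v → (A v Bool.≟ true) ×-dec (3 ≤? degIn A v))
    ...   | yes (v , av , d≥3) = delete A av d≥3 ≤-refl (induct k (A ─ v) (≤-trans (≤-reflexive (sym (#-─ A av))) A≤k))
    ...   | no no-high with any? (λ v → (A v Bool.≟ true) ×-dec (degIn A v ≤? 1))
    ...     | yes (v , av , d≤1) = relax z≤n (low-degree A v av d≤1 (λ A′ lt → induct k A′ (≤-trans lt A≤k)))
    ...     | no no-low = two-regular
      where
      deg≥2 : ∀ {v} → A v ≡ true → 2 ≤ degIn A v
      deg≥2 {v} av = ≰⇒> λ le → no-low (v , av , le)
      deg≤2 : ∀ {v} → A v ≡ true → degIn A v ≤ 2
      deg≤2 {v} av = ≤-pred (≰⇒> λ le → no-high (v , av , le))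
      two-regular : Separated A 0
      two-regular with #-witness {f = at A v₀} (≤-trans (n≤1+n 1) (deg≥2 av₀))
      ... | e , he with second-edge A v₀ (deg≥2 av₀) he
      ...   | f , f≢e , hf with neighbour A he | neighbour A hf
      ...     | a , je , aa | b , jf , ab = cases (a ≟ b) (any? (λ h → joins? h a b))
        where
        v : Vertex G
        v = v₀
        ih : ∀ A′ → # A′ < # A → Separated A′ 0
        ih A′ lt = induct k A′ (≤-trans lt A≤k)
        joins? : ∀ h a b → Dec (Joins G h a b)
        joins? h a b = ((p₁ h ≟ a) ×-dec (p₂ h ≟ b)) ⊎-dec ((p₁ h ≟ b) ×-dec (p₂ h ≟ a))
        v≢a : v ≢ a
        v≢a = Joins-≢ je
        v≢b : v ≢ b
        v≢b = Joins-≢ jf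
        shrink : ∀ {B : Vertex G → Bool} {x} → B x ≡ true → # (B ─ x) < # B
        shrink {B} bx = ≤-reflexive (sym (#-─ B bx))
        either : ∀ {h c} → Joins G h v c → A c ≡ true → c ≡ a ⊎ c ≡ b
        either {h} jh ac with h ≟ e | h ≟ f
        ... | yes refl | _        = inj₁ (Joins-unique jh je)
        ... | no _     | yes refl = inj₂ (Joins-unique jh jf)
        ... | no h≢e   | no h≢f   = ⊥-elim (<-irrefl refl (≤-trans three (deg≤2 av₀)))
          where
          three : 3 ≤ degIn A v
          three = ≤-trans (s≤s (s≤s (#-pos {f = λ i → i == h} h (==-refl h))))
            (#-two (at A v) (λ i → i == h) (λ i q → subst (λ i → at A v i ≡ true) (sym (==⇒≡ {i = i} q)) (at-intro A jh av₀ ac))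
              f≢e hf he (≢⇒== (h≢f ∘ sym)) (≢⇒== (h≢e ∘ sym)))
        cases : Dec (a ≡ b) → Dec (∃ λ h → Joins G h a b) → Separated A 0
        -- Two parallel edges form a component: absorbing `v` is free and isolates `a`.
        cases (yes refl) _ = absorb A av₀ (deg≥2 av₀) (m≤m+n 4 3) simplicial
          (isolate (A ─ v) (─-true A aa (v≢a ∘ sym)) a-isolated (ih _ (<-trans (shrink {A ─ v} (─-true A aa (v≢a ∘ sym))) (shrink av₀))))
          where
          simplicial : Simplicial A v
          simplicial jx jy ax ay with either jx ax | either jy ay
          ... | inj₁ refl | inj₁ refl = inj₁ refl
          ... | inj₁ refl | inj₂ refl = inj₁ refl
          ... | inj₂ refl | inj₁ refl = inj₁ refl
          ... | inj₂ refl | inj₂ refl = inj₁ refl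
          a-isolated : degIn (A ─ v) a ≤ 0
          a-isolated = +-cancelˡ-≤ 2 _ _ (≤-trans
            (#-two (at A a) (at (A ─ v) a) (λ e → at-─ A {e = e}) f≢e (at-intro A (flip jf) aa av₀) (at-intro A (flip je) aa av₀)
              (at-─-gone A (Joins-inc jf)) (at-─-gone A (Joins-inc je)))
            (deg≤2 aa))
        -- A triangle: absorbing `v` is free and leaves `a` with degree at most 1.
        cases (no a≢b) (yes (h , jh)) = absorb A av₀ (deg≥2 av₀) (n≤1+n 4) simplicial
          (low-degree (A ─ v) a (─-true A aa (v≢a ∘ sym)) (≤-pred (≤-trans (degIn-drop A (flip je) aa av₀) (deg≤2 aa)))
            (λ A′ lt → ih A′ (<-trans lt (shrink av₀))))
          where
          simplicial : Simplicial A v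
          simplicial jx jy ax ay with either jx ax | either jy ay
          ... | inj₁ refl | inj₁ refl = inj₁ refl
          ... | inj₁ refl | inj₂ refl = inj₂ (h , jh)
          ... | inj₂ refl | inj₁ refl = inj₂ (h , flip jh)
          ... | inj₂ refl | inj₂ refl = inj₁ refl
        cases (no a≢b) (no ¬ab) with second-edge A b (deg≥2 ab) (at-intro A (flip jf) ab av₀)
        ... | g , g≢f , hg with neighbour A hg
        ...   | w , jg , aw =
          -- The balance is exact: two deletions lose 2 each, isolating `v` gains 3, and the second
          -- neighbour `w` of `b`, now of degree at most 1, gains 1.
          delete A aa (deg≥2 aa) ≤-refl
            (delete (A ─ a) ab′ b-deg ≤-refl
              (isolate A₂ av₂ v-isolated
                (low-degree (A₂ ─ v) w aw₃ w-low (λ A′ lt → ih A′ (<-trans lt (<-trans (shrink {A₂} av₂) (<-trans (shrink {A ─ a} ab′) (shrink aa))))))))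
          where
          A₂ : Vertex G → Bool
          A₂ = A ─ a ─ b
          ab′ : (A ─ a) b ≡ true
          ab′ = ─-true A ab (a≢b ∘ sym)
          av₂ : A₂ v ≡ true
          av₂ = ─-true (A ─ a) (─-true A av₀ v≢a) v≢b
          w≢a : w ≢ a
          w≢a refl = ¬ab (g , flip jg)
          w≢v : w ≢ v
          w≢v refl with g ≟ e
          ... | yes refl = a≢b (Joins-unique je (flip jg))
          ... | no g≢e   = ⊥-elim (<-irrefl refl (≤-trans (≤-trans (s≤s (s≤s (#-pos {f = λ i → i == e} e (==-refl e))))
            (#-two (at A v) (λ i → i == e) (λ i q → subst (λ i → at A v i ≡ true) (sym (==⇒≡ {i = i} q)) he)
              g≢f (at-intro A (flip jg) av₀ ab) hf (≢⇒== g≢e) (≢⇒== f≢e))) (deg≤2 av₀)))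
          aw₃ : (A₂ ─ v) w ≡ true
          aw₃ = ─-true A₂ (─-true (A ─ a) (─-true A aw w≢a) (Joins-≢ jg ∘ sym)) w≢v
          b-deg : 2 ≤ degIn (A ─ a) b
          b-deg = ≤-trans (deg≥2 ab) (#-mono away)
            where
            away : ∀ i → at A b i ≡ true → at (A ─ a) b i ≡ true
            away i q with neighbour A q
            ... | c , ji , ac = at-intro (A ─ a) ji ab′ (─-true A ac (λ { refl → ¬ab (i , flip ji) }))
          v-isolated : degIn A₂ v ≤ 0
          v-isolated = +-cancelˡ-≤ 2 _ _ (≤-trans
            (#-two (at A v) (at A₂ v) (λ i q → at-─ A {e = i} (at-─ (A ─ a) {e = i} q)) f≢e hf he
              (at-─-gone (A ─ a) (Joins-inc (flip jf)))
              (¬true⇒false λ q → true≢false (at-─ (A ─ a) {e = e} q) (at-─-gone A (Joins-inc (flip je)))))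
            (deg≤2 av₀))
          w-low : degIn (A₂ ─ v) w ≤ 1
          w-low = ≤-pred (≤-trans (s≤s (degIn-anti A₂)) (≤-trans
            (degIn-drop (A ─ a) (flip jg) (─-true A aw w≢a) ab′) (≤-trans (degIn-anti A) (deg≤2 aw))))

-- Degree parities

odd : ℕ → Bool
odd zero    = false
odd (suc k) = not (odd k)

odd-# : ∀ {n} (f : Fin n → Bool) → odd (# f) ≡ ⊕ f
odd-# f = trans (cong odd (#≡sum f)) (go f)
  where
  go : ∀ {n} (f : Fin n → Bool) → odd (sum (λ i → ⟦ f i ⟧)) ≡ ⊕ f
  go {zero}  f = refl
  go {suc n} f with f zero
  ... | true  = cong not (go (f ∘ suc))
  ... | false = go (f ∘ suc)

⊕-zero : ∀ {n} {f : Fin n → Bool} → (∀ i → f i ≡ false) → ⊕ f ≡ false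
⊕-zero {zero}  h = refl
⊕-zero {suc n} h = cong₂ _xor_ (h zero) (⊕-zero (h ∘ suc))

⊕-∧ : ∀ {n} (f : Fin n → Bool) c → ⊕ (λ i → f i ∧ c) ≡ ⊕ f ∧ c
⊕-∧ f true  = trans (⊕-cong (λ i → ∧-identityʳ (f i))) (sym (∧-identityʳ (⊕ f)))
⊕-∧ f false = trans (⊕-zero (λ i → ∧-zeroʳ (f i))) (sym (∧-zeroʳ (⊕ f)))

⊕-pick : ∀ {n} (x : Fin n) (f : Fin n → Bool) → ⊕ (λ i → i == x ∧ f i) ≡ f x
⊕-pick {suc n} zero f = trans (cong (f zero xor_) (⊕-zero {n} (λ _ → refl))) (xor-identityʳ (f zero))
⊕-pick (suc x)      f = ⊕-pick x (f ∘ suc)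

module Parity (G : Graph) where

  open Walks G
  open Swaps G
  open Barriers G
  open Separation G

  parity : (Edge G → Bool) → Vertex G → Bool
  parity F v = ⊕ (λ e → F e ∧ inc v e)

  inc-xor : ∀ v e → inc v e ≡ (p₁ e == v) xor (p₂ e == v)
  inc-xor v e with p₁ e ≟ v | p₂ e ≟ v
  ... | yes a | yes b = ⊥-elim (noLoop G e (trans a (sym b)))
  ... | yes _ | no  _ = refl
  ... | no  _ | yes _ = refl
  ... | no  _ | no  _ = refl

  handshake : ∀ F → ⊕ (parity F) ≡ false
  handshake F = trans (⊕-comm (λ v e → F e ∧ inc v e)) (⊕-zero even)
    where
    even : ∀ e → ⊕ (λ v → F e ∧ inc v e) ≡ false
    even e = begin
      ⊕ (λ v → F e ∧ inc v e)                                 ≡⟨ ⊕-cong (λ v → trans (∧-comm (F e) (inc v e)) (cong (_∧ F e) (inc-xor v e))) ⟩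
      ⊕ (λ v → ((p₁ e == v) xor (p₂ e == v)) ∧ F e)           ≡⟨ ⊕-∧ (λ v → (p₁ e == v) xor (p₂ e == v)) (F e) ⟩
      ⊕ (λ v → (p₁ e == v) xor (p₂ e == v)) ∧ F e             ≡⟨ cong (_∧ F e) (⊕-xor (p₁ e ==_) (p₂ e ==_)) ⟩
      (⊕ (p₁ e ==_) xor ⊕ (p₂ e ==_)) ∧ F e                   ≡⟨ cong (_∧ F e) (cong₂ _xor_ (one (p₁ e)) (one (p₂ e))) ⟩
      false                                                   ∎
      where
      open ≡-Reasoning
      one : ∀ {n} (x : Fin n) → ⊕ (x ==_) ≡ true
      one x = trans (sym (odd-# (x ==_))) (cong odd (#-single′ x))

  -- The edge set `J` is a t-join inside `T`.
  Realisable : (Edge G → Bool) → (Vertex G → Bool) → Set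
  Realisable T t = ∃ λ J → (∀ e → J e ≡ true → T e ≡ true) × (∀ v → parity J v ≡ t v)

  realise-cong : ∀ {T t t′} → (∀ v → t v ≡ t′ v) → Realisable T t → Realisable T t′
  realise-cong eq (J , J⊆T , par) = J , J⊆T , λ v → trans (par v) (eq v)

  realise-zero : ∀ {T} → Realisable T (λ _ → false)
  realise-zero = (λ _ → false) , (λ _ ()) , (λ _ → ⊕-zero {m G} (λ _ → refl))

  realise-xor : ∀ {T t t′} → Realisable T t → Realisable T t′ → Realisable T (λ v → t v xor t′ v)
  realise-xor {T} {t} {t′} (J , J⊆T , par) (J′ , J′⊆T , par′) = (λ e → J e xor J′ e) , sub , λ v → begin
      ⊕ (λ e → (J e xor J′ e) ∧ inc v e)              ≡⟨ ⊕-cong (λ e → ∧-distribʳ-xor (inc v e) (J e) (J′ e)) ⟩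
      ⊕ (λ e → (J e ∧ inc v e) xor (J′ e ∧ inc v e))  ≡⟨ ⊕-xor (λ e → J e ∧ inc v e) (λ e → J′ e ∧ inc v e) ⟩
      parity J v xor parity J′ v                      ≡⟨ cong₂ _xor_ (par v) (par′ v) ⟩
      t v xor t′ v                                    ∎
    where
    open ≡-Reasoning
    sub : ∀ e → J e xor J′ e ≡ true → T e ≡ true
    sub e h with J e in je | J′ e in je′
    ... | true  | _    = J⊆T e je
    ... | false | true = J′⊆T e je′

  realise-sum : ∀ {T k} (t : Fin k → Vertex G → Bool) → (∀ i → Realisable T (t i)) → Realisable T (λ v → ⊕ (λ i → t i v))
  realise-sum {k = zero}  t h = realise-zero
  realise-sum {k = suc k} t h = realise-xor (h zero) (realise-sum (t ∘ suc) (h ∘ suc))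

  realise-∧ : ∀ {T t} c → Realisable T t → Realisable T (λ v → c ∧ t v)
  realise-∧ true  h = h
  realise-∧ false h = realise-zero

  realise-edge : ∀ {T e u w} → T e ≡ true → Joins G e u w → Realisable T (λ v → (u == v) xor (w == v))
  realise-edge {T} {e} te j =
    (λ f → f == e) , (λ f h → subst (λ f → T f ≡ true) (sym (==⇒≡ {i = f} h)) te) ,
    λ v → trans (⊕-pick e (inc v)) (trans (inc-xor v e) (orient j v))
    where
    orient : ∀ {u w} → Joins G e u w → ∀ v → (p₁ e == v) xor (p₂ e == v) ≡ (u == v) xor (w == v)
    orient (inj₁ (refl , refl)) v = refl
    orient (inj₂ (refl , refl)) v = xor-comm (p₁ e == v) (p₂ e == v)

  realise-path : ∀ {T u w} → Path (λ e → T e ≡ true) u w → Realisable T (λ v → (u == v) xor (w == v))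
  realise-path {u = u} done = realise-cong (λ v → sym (xor-same (u == v))) realise-zero
  realise-path {u = u} (via {w = x} {v = w} e te j p) = realise-cong telescope (realise-xor (realise-edge te j) (realise-path p))
    where
    telescope : ∀ v → ((u == v) xor (x == v)) xor ((x == v) xor (w == v)) ≡ (u == v) xor (w == v)
    telescope v with u == v | x == v | w == v
    ... | false | false | _     = refl
    ... | false | true  | true  = refl
    ... | false | true  | false = refl
    ... | true  | false | _     = refl
    ... | true  | true  | true  = refl
    ... | true  | true  | false = refl

  -- Walks from all vertices of `t` to `r` are added modulo 2; as `t` is even, their contributions
  -- at `r` cancel.
  realise-even : ∀ T → Spans T → (r : Vertex G) → ∀ t → ⊕ t ≡ false → Realisable T t
  realise-even T conn r t even = realise-cong total-parity
      (realise-sum (λ v w → t v ∧ ((v == w) xor (r == w))) (λ v → realise-∧ (t v) (realise-path (conn v r))))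
    where
    open ≡-Reasoning
    total-parity : ∀ w → ⊕ (λ v → t v ∧ ((v == w) xor (r == w))) ≡ t w
    total-parity w = begin
      ⊕ (λ v → t v ∧ ((v == w) xor (r == w)))                 ≡⟨ ⊕-cong (λ v → trans (∧-distribˡ-xor (t v) (v == w) (r == w))
                                                                              (cong (_xor (t v ∧ r == w)) (∧-comm (t v) (v == w)))) ⟩
      ⊕ (λ v → (v == w ∧ t v) xor (t v ∧ r == w))             ≡⟨ ⊕-xor (λ v → v == w ∧ t v) (λ v → t v ∧ r == w) ⟩
      ⊕ (λ v → v == w ∧ t v) xor ⊕ (λ v → t v ∧ r == w)       ≡⟨ cong₂ _xor_ (⊕-pick w t) (⊕-∧ t (r == w)) ⟩
      t w xor (⊕ t ∧ r == w)                                  ≡⟨ cong (λ z → t w xor (z ∧ r == w)) even ⟩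
      t w xor false                                           ≡⟨ xor-identityʳ (t w) ⟩
      t w                                                     ∎

  even-2-4 : ∀ d → odd d ≡ false → 1 ≤ d → d ≤ 5 → d ≡ 2 ⊎ d ≡ 4
  even-2-4 2 _ _ _ = inj₁ refl
  even-2-4 4 _ _ _ = inj₂ refl
  even-2-4 (suc (suc (suc (suc (suc (suc d)))))) _ _ (s≤s (s≤s (s≤s (s≤s (s≤s ())))))

  Is24 : (Edge G → Bool) → Set
  Is24 F = ∀ v → # (λ e → F e ∧ inc v e) ≡ 2 ⊎ # (λ e → F e ∧ inc v e) ≡ 4

  even-factor : 2 ≤ n G → ∀ c → Packing c → (∀ v → deg c v ≤ 5) → ∃ λ F → Is24 F × Spans F
  even-factor 2≤n c packing deg≤5 = F , is24 , spans
    where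
    T₁ T₂ : Edge G → Bool
    T₁ e = has true (c e)
    T₂ e = has false (c e)
    root : Vertex G
    root = subst Fin (m+[n∸m]≡n 2≤n) zero
    correction : Realisable T₂ (parity T₁)
    correction = realise-even T₂ (Packing.spans packing false) root (parity T₁) (handshake T₁)
    J : Edge G → Bool
    J = proj₁ correction
    -- `J` lies in the second tree and so misses `T₁`: the symmetric difference contains `T₁` and
    -- stays connected.
    F : Edge G → Bool
    F e = T₁ e xor J e
    T₁⊆F : ∀ e → T₁ e ≡ true → F e ≡ true
    T₁⊆F e t with c e | J e | proj₁ (proj₂ correction) e
    ... | just true | false | _ = refl
    ... | just true | true  | h with () ← h refl
    F⊆c : ∀ e → F e ≡ true → is-just (c e) ≡ true
    F⊆c e t with c e | J e | proj₁ (proj₂ correction) e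
    ... | just _  | _    | _ = refl
    ... | nothing | true | h with () ← h refl
    spans : Spans F
    spans u v = weaken T₁⊆F (Packing.spans packing true u v)
    is24 : Is24 F
    is24 v = even-2-4 _ even positive bounded
      where
      even : odd (# (λ e → F e ∧ inc v e)) ≡ false
      even = begin
        odd (# (λ e → F e ∧ inc v e))                       ≡⟨ odd-# (λ e → F e ∧ inc v e) ⟩
        parity F v                                          ≡⟨ ⊕-cong (λ e → ∧-distribʳ-xor (inc v e) (T₁ e) (J e)) ⟩
        ⊕ (λ e → (T₁ e ∧ inc v e) xor (J e ∧ inc v e))      ≡⟨ ⊕-xor (λ e → T₁ e ∧ inc v e) (λ e → J e ∧ inc v e) ⟩
        parity T₁ v xor parity J v                          ≡⟨ cong (parity T₁ v xor_) (proj₂ (proj₂ correction) v) ⟩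
        parity T₁ v xor parity T₁ v                         ≡⟨ xor-same (parity T₁ v) ⟩
        false                                               ∎
        where open ≡-Reasoning
      bounded : # (λ e → F e ∧ inc v e) ≤ 5
      bounded = ≤-trans (#-mono λ e h → true-∧ (F⊆c e (proj₁ (∧-true {F e} h))) (proj₂ (∧-true {F e} h))) (deg≤5 v)
      leaving : ∀ {w} → w ≢ v → Path (λ e → F e ≡ true) v w → 1 ≤ # (λ e → F e ∧ inc v e)
      leaving w≢v done           = ⊥-elim (w≢v refl)
      leaving w≢v (via e fe j p) = #-pos e (true-∧ fe (Joins-inc j))
      other : ∃ λ w → w ≢ v
      other with any? (λ w → ¬? (w ≟ v))
      ... | yes w = w
      ... | no none = ⊥-elim (<-irrefl refl (≤-trans 2≤n (≤-trans (≤-reflexive (sym (#-all (n G))))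
                        (≤-trans (#-mono all-v) (≤-reflexive (#-single v))))))
        where
        all-v : ∀ w → true ≡ true → w == v ≡ true
        all-v w _ with w ≟ v
        ... | yes _  = refl
        ... | no w≢v = ⊥-elim (none (w , w≢v))
      -- There is a second vertex, so connectedness excludes degree 0.
      positive : 1 ≤ # (λ e → F e ∧ inc v e)
      positive = leaving (proj₂ other) (spans v (proj₁ other))

-- s = |S|, o = |V ∖ S|, r classes, x crossing edges, h the degree sum over S; per tree, k edges inside classes,
-- l edges not inside S and t edges in total.
count-bound : ∀ s o r x h k k′ l l′ t → suc t ≡ s + o →
              o ≤ r + k → o ≤ r + k′ → s + o ≤ s + l → s + o ≤ s + l′ → 5 * s + 1 ≤ h →
              h + (k + k′) + x + (l + l′) ≤ 2 * (t + t) → s + 5 + x ≤ 2 * r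
count-bound s o r x h k k′ l l′ t tN ok ok′ Nl Nl′ hs ec = cancel K left right total
  where
  K T : ℕ
  K = 4 * (s + o) + 2 * s + h + (k + k′) + (l + l′)
  T = h + (k + k′) + x + (l + l′)
  -- Two trees of n - 1 edges, each edge counted twice, give 4n - 4. This 4 and the 1 in `5 * s + 1`
  -- make up the constant 5.
  four : 4 + 2 * (t + t) ≡ 4 * (s + o)
  four = trans (e t) (cong (4 *_) tN)
    where
    e : ∀ t → 4 + 2 * (t + t) ≡ 4 * suc t
    e = solve-∀
  edges : 4 + T ≤ 4 * (s + o)
  edges = ≤-trans (+-monoʳ-≤ 4 ec) (≤-reflexive four)
  total : o + o + (s + o + (s + o)) + (5 * s + 1 + (4 + T)) ≤ r + k + (r + k′) + (s + l + (s + l′)) + (h + 4 * (s + o))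
  total = +-mono-≤ (+-mono-≤ (+-mono-≤ ok ok′) (+-mono-≤ Nl Nl′)) (+-mono-≤ hs edges)
  left : s + 5 + x + K ≡ o + o + (s + o + (s + o)) + (5 * s + 1 + (4 + T))
  left = e s o x h k k′ l l′
    where
    e : ∀ s o x h k k′ l l′ → s + 5 + x + (4 * (s + o) + 2 * s + h + (k + k′) + (l + l′)) ≡
        o + o + (s + o + (s + o)) + (5 * s + 1 + (4 + (h + (k + k′) + x + (l + l′))))
    e = solve-∀
  right : 2 * r + K ≡ r + k + (r + k′) + (s + l + (s + l′)) + (h + 4 * (s + o))
  right = e s o r h k k′ l l′
    where
    e : ∀ s o r h k k′ l l′ → 2 * r + (4 * (s + o) + 2 * s + h + (k + k′) + (l + l′)) ≡
        r + k + (r + k′) + (s + l + (s + l′)) + (h + 4 * (s + o))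
    e = solve-∀

-- r classes, z of them uncut and d cut; e crossing edges between representatives, f the others; x extra cut vertices;
-- w the size of the whole cut, k separated vertices, c components.
final-bound : ∀ s x r z d e f k c w → 6 * r + 0 ≤ 7 * k + 2 * e + 2 * z → s + 5 + (e + f) ≤ 2 * r → r ≡ z + d →
              x ≤ f → w ≤ s + x + d → k ≤ c → 7 * c ≤ 2 * w + 9 → 10 ≤ 9
final-bound s x r z d e f k c w sep classes r≡ xf ws kc tough =
  -- The class bound is taken twice, which turns its 5 into the 10 that meets the 9 of the
  -- hypothesis.
  cancel K left right (+-mono-≤ (+-mono-≤ (+-mono-≤ sep (*-monoʳ-≤ 2 classes)) (+-mono-≤ (*-monoʳ-≤ 2 (≤-reflexive (sym r≡))) (*-monoʳ-≤ 2 xf)))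
                                (+-mono-≤ (*-monoʳ-≤ 2 ws) (+-mono-≤ (*-monoʳ-≤ 7 kc) tough)))
  where
  K : ℕ
  K = 6 * r + 2 * s + 2 * e + 2 * f + 2 * z + 2 * d + 2 * x + 2 * w + 7 * k + 7 * c
  left : 10 + K ≡ 6 * r + 0 + 2 * (s + 5 + (e + f)) + (2 * (z + d) + 2 * x) + (2 * w + (7 * k + 7 * c))
  left = eq s x r z d e f k c w
    where
    eq : ∀ s x r z d e f k c w → 10 + (6 * r + 2 * s + 2 * e + 2 * f + 2 * z + 2 * d + 2 * x + 2 * w + 7 * k + 7 * c) ≡
         6 * r + 0 + 2 * (s + 5 + (e + f)) + (2 * (z + d) + 2 * x) + (2 * w + (7 * k + 7 * c))
    eq = solve-∀
  right : 9 + K ≡ 7 * k + 2 * e + 2 * z + 2 * (2 * r) + (2 * r + 2 * f) + (2 * (s + x + d) + (7 * c + (2 * w + 9)))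
  right = eq s x r z d e f k c w
    where
    eq : ∀ s x r z d e f k c w → 9 + (6 * r + 2 * s + 2 * e + 2 * f + 2 * z + 2 * d + 2 * x + 2 * w + 7 * k + 7 * c) ≡
         7 * k + 2 * e + 2 * z + 2 * (2 * r) + (2 * r + 2 * f) + (2 * (s + x + d) + (7 * c + (2 * w + 9)))
    eq = solve-∀

-- Counting tree edges around a barrier and cutting between classes

module Counting (G : Graph) where

  open Walks G
  open Swaps G
  open Barriers G
  open Separation G

  module _ (b : Colouring) (packed : Packing b) (minimal : ∀ c → Packing c → total b ≤ total c) where

    open Minimal b packed minimal

    module _ {u : Vertex G} (bar : Barrier u) (u-heavy : 6 ≤ deg b u)
             (linked? : ∀ v w → Dec (Linked (Barrier.S bar) v w)) where

      open Barrier bar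

      outside : Vertex G → Bool
      outside v = not (S v)

      -- The vertex of least index in its class. With one vertex per class, no quotient graph is
      -- needed: `separable` applies to the subgraph induced on the representatives.
      Representative : Vertex G → Set
      Representative v = S v ≡ false × (∀ w → Linked S v w → toℕ v ≤ toℕ w)

      representative? : ∀ v → Dec (Representative v)
      representative? v = (S v Bool.≟ false) ×-dec all? (λ w → linked? v w →-dec (toℕ v ≤? toℕ w))

      opaque

        R : Vertex G → Bool
        R v = does (representative? v)

        R⇒ : ∀ {v} → R v ≡ true → Representative v
        R⇒ {v} = does⇒ (representative? v)

        ⇒R : ∀ {v} → Representative v → R v ≡ true
        ⇒R {v} = dec-true (representative? v)

      R-unique : ∀ {v w} → R v ≡ true → R w ≡ true → Linked S v w → v ≡ w
      R-unique rv rw l = toℕ-injective (≤-antisym (proj₂ (R⇒ rv) _ l) (proj₂ (R⇒ rw) _ (linked-sym l)))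

      R-exists : ∀ v → S v ≡ false → ∃ λ r → R r ≡ true × Linked S v r
      R-exists v sv = search (suc (toℕ v)) v ≤-refl sv
        where
        search : ∀ k v → toℕ v < k → S v ≡ false → ∃ λ r → R r ≡ true × Linked S v r
        search (suc k) v (s≤s v≤k) sv with any? (λ w → linked? v w ×-dec (toℕ w <? toℕ v))
        ... | yes (w , l , w<v) with search k w (≤-trans w<v v≤k) (linked-right l)
        ...   | r , rr , l′ = r , rr , linked-trans l l′
        search (suc k) v (s≤s v≤k) sv | no least =
          v , ⇒R (sv , λ w l → ≮⇒≥ (λ lt → least (w , l , lt))) , linked-refl sv

      joined : Edge G → Bool
      joined e = does (linked? (p₁ e) (p₂ e))

      crosses : Edge G → Bool
      crosses e = inside outside e ∧ not (joined e)

      classEdge : Bool → Edge G → Bool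
      classEdge i e = has i (b e) ∧ joined e

      treeEdge : Bool → Edge G → Bool
      treeEdge i e = has i (b e)

      leaving : Bool → Edge G → Bool
      leaving i e = has i (b e) ∧ not (inside S e)

      n≡ : # S + # outside ≡ n G
      n≡ = trans (sym (sum-# S outside)) (trans (sum-cong-≗ one) (trans (sym (#≡sum (λ (_ : Vertex G) → true))) (#-all (n G))))
        where
        one : ∀ v → ⟦ S v ⟧ + ⟦ not (S v) ⟧ ≡ 1
        one v with S v
        ... | true  = refl
        ... | false = refl

      -- Each class is connected in tree `i`, so growing from the representatives uses one edge
      -- inside a class for every other vertex.
      classes-spanned : ∀ i → # outside ≤ # R + # (classEdge i)
      classes-spanned i = ≤-trans
          (growth (classEdge i) R outside (λ v rv → true-not (proj₁ (R⇒ rv))) within reach)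
          (+-monoʳ-≤ (# R) (#-mono λ e h → proj₁ (∧-true {classEdge i e} h)))
        where
        within : ∀ e → classEdge i e ≡ true → inside outside e ≡ true
        within e h with does⇒ (linked? (p₁ e) (p₂ e)) (proj₂ (∧-true {has i (b e)} h))
        ... | l = true-∧ (true-not (linked-left l)) (true-not (linked-right l))
        reach : ∀ v → outside v ≡ true → ∃ λ r → R r ≡ true × Path (λ e → classEdge i e ≡ true) v r
        reach v sv with R-exists v (not-true sv)
        ... | r , rr , l = r , rr , weaken (λ e (t , p , q) →
            true-∧ t (dec-true (linked? (p₁ e) (p₂ e)) (linked-trans (linked-sym p) q))) (linked-path l i)

      -- Growing from `S` through tree `i` uses, for every vertex outside, a new edge that is not
      -- inside `S`.
      barrier-spanned : ∀ i → n G ≤ # S + # (leaving i)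
      barrier-spanned i = ≤-trans (≤-reflexive (sym (#-all (n G))))
        (growth (treeEdge i) S (λ _ → true) (λ _ _ → refl) (λ _ _ → refl) (λ v _ → u , u∈S , Packing.spans packed i v u))

      hits : (Edge G → Vertex G) → Edge G → Bool
      hits p e = is-just (b e) ∧ S (p e)

      -- The additional 1 comes from `u`, whose degree is at least 6.
      heavy-sum : 5 * # S + 1 ≤ # (hits p₁) + # (hits p₂)
      heavy-sum = begin
        5 * # S + 1                                              ≡⟨ +-comm _ 1 ⟩
        suc (5 * # S)                                            ≡⟨ cong suc (sum-*# 5 S) ⟨
        suc (sum (λ v → 5 * ⟦ S v ⟧))                            ≤⟨ sum-mono-< weak u strictly ⟩
        sum (λ v → # (λ e → S v ∧ (is-just (b e) ∧ inc v e)))    ≡⟨ #-comm (λ v e → S v ∧ (is-just (b e) ∧ inc v e)) ⟩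
        sum (λ e → # (λ v → S v ∧ (is-just (b e) ∧ inc v e)))    ≡⟨ sum-cong-≗ at-edge ⟩
        sum (λ e → ⟦ hits p₁ e ⟧ + ⟦ hits p₂ e ⟧)                ≡⟨ sum-# (hits p₁) (hits p₂) ⟩
        # (hits p₁) + # (hits p₂)                                ∎
        where
        open ≤-Reasoning
        weak : ∀ v → 5 * ⟦ S v ⟧ ≤ # (λ e → S v ∧ (is-just (b e) ∧ inc v e))
        weak v with S v in sv
        ... | true  = heavy v sv
        ... | false = z≤n
        strictly : 5 * ⟦ S u ⟧ < # (λ e → S u ∧ (is-just (b e) ∧ inc u e))
        strictly rewrite u∈S = u-heavy
        at-edge : ∀ e → # (λ v → S v ∧ (is-just (b e) ∧ inc v e)) ≡ ⟦ hits p₁ e ⟧ + ⟦ hits p₂ e ⟧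
        at-edge e = trans (#-split {g = λ v → v == p₁ e ∧ (is-just (b e) ∧ S v)} {h = λ v → v == p₂ e ∧ (is-just (b e) ∧ S v)} pointwise)
          (cong₂ _+_ (#-pick (p₁ e) (λ v → is-just (b e) ∧ S v)) (#-pick (p₂ e) (λ v → is-just (b e) ∧ S v)))
          where
          pointwise : ∀ v → ⟦ S v ∧ (is-just (b e) ∧ inc v e) ⟧ ≡
                            ⟦ v == p₁ e ∧ (is-just (b e) ∧ S v) ⟧ + ⟦ v == p₂ e ∧ (is-just (b e) ∧ S v) ⟧
          pointwise v rewrite ==-sym v (p₁ e) | ==-sym v (p₂ e) with p₁ e ≟ v | p₂ e ≟ v | S v | is-just (b e)
          ... | yes x | yes y | _     | _     = ⊥-elim (noLoop G e (trans x (sym y)))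
          ... | yes _ | no  _ | true  | true  = refl
          ... | yes _ | no  _ | true  | false = refl
          ... | yes _ | no  _ | false | true  = refl
          ... | yes _ | no  _ | false | false = refl
          ... | no  _ | yes _ | true  | true  = refl
          ... | no  _ | yes _ | true  | false = refl
          ... | no  _ | yes _ | false | true  = refl
          ... | no  _ | yes _ | false | false = refl
          ... | no  _ | no  _ | true  | true  = refl
          ... | no  _ | no  _ | true  | false = refl
          ... | no  _ | no  _ | false | true  = refl
          ... | no  _ | no  _ | false | false = refl

      -- Edge by edge: a coloured edge meets S twice, or meets S once and leaves S, or lies in a
      -- class, or crosses; in every case it contributes at most 2 on the left.
      edge-count : # (hits p₁) + # (hits p₂) + (# (classEdge true) + # (classEdge false)) + # crosses
                   + (# (leaving true) + # (leaving false)) ≤ 2 * (# (treeEdge true) + # (treeEdge false))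
      edge-count = subst₂ _≤_ lhs rhs (sum-mono pointwise)
        where
        meeting inClass passing : Edge G → ℕ
        meeting e = ⟦ hits p₁ e ⟧ + ⟦ hits p₂ e ⟧
        inClass e = ⟦ classEdge true e ⟧ + ⟦ classEdge false e ⟧
        passing e = ⟦ leaving true e ⟧ + ⟦ leaving false e ⟧
        lhs : sum (λ e → meeting e + inClass e + ⟦ crosses e ⟧ + passing e) ≡
              # (hits p₁) + # (hits p₂) + (# (classEdge true) + # (classEdge false)) + # crosses + (# (leaving true) + # (leaving false))
        lhs = begin
          sum (λ e → meeting e + inClass e + ⟦ crosses e ⟧ + passing e)
            ≡⟨ ∑-distrib-+ (λ e → meeting e + inClass e + ⟦ crosses e ⟧) passing ⟩
          sum (λ e → meeting e + inClass e + ⟦ crosses e ⟧) + sum passing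
            ≡⟨ cong (_+ sum passing) (∑-distrib-+ (λ e → meeting e + inClass e) (λ e → ⟦ crosses e ⟧)) ⟩
          sum (λ e → meeting e + inClass e) + sum (λ e → ⟦ crosses e ⟧) + sum passing
            ≡⟨ cong (λ t → t + sum (λ e → ⟦ crosses e ⟧) + sum passing) (∑-distrib-+ meeting inClass) ⟩
          sum meeting + sum inClass + sum (λ e → ⟦ crosses e ⟧) + sum passing
            ≡⟨ cong₂ _+_ (cong₂ _+_ (cong₂ _+_ (sum-# (hits p₁) (hits p₂)) (sum-# (classEdge true) (classEdge false)))
                                    (sym (#≡sum crosses)))
                         (sum-# (leaving true) (leaving false)) ⟩
          # (hits p₁) + # (hits p₂) + (# (classEdge true) + # (classEdge false)) + # crosses + (# (leaving true) + # (leaving false)) ∎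
          where open ≡-Reasoning
        rhs : sum (λ e → 2 * (⟦ treeEdge true e ⟧ + ⟦ treeEdge false e ⟧)) ≡ 2 * (# (treeEdge true) + # (treeEdge false))
        rhs = trans (sym (*-distribˡ-sum 2 (λ e → ⟦ treeEdge true e ⟧ + ⟦ treeEdge false e ⟧)))
                    (cong (2 *_) (sum-# (treeEdge true) (treeEdge false)))
        pointwise : ∀ e → meeting e + inClass e + ⟦ crosses e ⟧ + passing e ≤ 2 * (⟦ treeEdge true e ⟧ + ⟦ treeEdge false e ⟧)
        pointwise e with b e | crossing e | linked? (p₁ e) (p₂ e) | S (p₁ e) in s₁ | S (p₂ e) in s₂
        ... | nothing    | h | yes _ | true  | true  = z≤n
        ... | nothing    | h | yes _ | true  | false = z≤n
        ... | nothing    | h | yes _ | false | true  = z≤n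
        ... | nothing    | h | yes _ | false | false = z≤n
        ... | nothing    | h | no _  | true  | _     = z≤n
        ... | nothing    | h | no _  | false | true  = z≤n
        ... | nothing    | h | no ¬l | false | false with () ← h s₁ s₂ ¬l
        ... | just true  | h | yes l | true  | _     = ⊥-elim (true≢false s₁ (linked-left l))
        ... | just true  | h | yes l | false | true  = ⊥-elim (true≢false s₂ (linked-right l))
        ... | just true  | h | yes _ | false | false = ≤-refl
        ... | just true  | h | no _  | true  | true  = ≤-refl
        ... | just true  | h | no _  | true  | false = ≤-refl
        ... | just true  | h | no _  | false | true  = ≤-refl
        ... | just true  | h | no _  | false | false = ≤-refl
        ... | just false | h | yes l | true  | _     = ⊥-elim (true≢false s₁ (linked-left l))
        ... | just false | h | yes l | false | true  = ⊥-elim (true≢false s₂ (linked-right l))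
        ... | just false | h | yes _ | false | false = ≤-refl
        ... | just false | h | no _  | true  | true  = ≤-refl
        ... | just false | h | no _  | true  | false = ≤-refl
        ... | just false | h | no _  | false | true  = ≤-refl
        ... | just false | h | no _  | false | false = ≤-refl

      class-bound : # S + 5 + # crosses ≤ 2 * # R
      class-bound = count-bound (# S) (# outside) (# R) (# crosses) (# (hits p₁) + # (hits p₂))
          (# (classEdge true)) (# (classEdge false)) (# (leaving true)) (# (leaving false)) (# (treeEdge true))
          (trans (Packing.size packed true) (sym n≡)) (classes-spanned true) (classes-spanned false)
          (≤-trans (≤-reflexive n≡) (barrier-spanned true)) (≤-trans (≤-reflexive n≡) (barrier-spanned false)) heavy-sum
          (≤-trans edge-count (≤-reflexive (cong (λ t → 2 * (# (treeEdge true) + t))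
            (cong (_∸ 1) (trans (Packing.size packed false) (sym (Packing.size packed true)))))))

      -- A crossing edge with an end that is not a representative is cut at such an end.
      stray : Edge G → Bool
      stray e = crosses e ∧ not (inside R e)

      strayEnd : Edge G → Vertex G
      strayEnd e = if R (p₁ e) then p₂ e else p₁ e

      strayEnd∉R : ∀ e → stray e ≡ true → R (strayEnd e) ≡ false
      strayEnd∉R e h with R (p₁ e) in r₁ | ∧-true {crosses e} h
      ... | true  | _ , q = not-true q
      ... | false | _ , _ = r₁

      X : Vertex G → Bool
      X v = does (any? λ e → (stray e Bool.≟ true) ×-dec (strayEnd e ≟ v))

      -- At most one cut vertex per stray edge. Stray edges are missing from the subgraph on `R` but
      -- present in the class bound, and there each pays for its vertex.
      X-size : # X ≤ # stray
      X-size = #-image stray strayEnd X (λ v → does⇒ (any? λ e → (stray e Bool.≟ true) ×-dec (strayEnd e ≟ v)))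

      X-strayEnd : ∀ e → stray e ≡ true → X (strayEnd e) ≡ true
      X-strayEnd e h = dec-true (any? λ e′ → (stray e′ Bool.≟ true) ×-dec (strayEnd e′ ≟ strayEnd e)) (e , h , refl)

      X∉R : ∀ {v} → X v ≡ true → R v ≡ false
      X∉R {v} h with does⇒ (any? λ e → (stray e Bool.≟ true) ×-dec (strayEnd e ≟ v)) h
      ... | e , st , refl = strayEnd∉R e st

      R-edge-crosses : ∀ e → inside R e ≡ true → crosses e ≡ true
      R-edge-crosses e h with ∧-true {R (p₁ e)} h
      ... | r₁ , r₂ = true-∧ {inside outside e} (true-∧ (true-not (proj₁ (R⇒ r₁))) (true-not (proj₁ (R⇒ r₂))))
                       (true-not (¬true⇒false λ l → noLoop G e (R-unique r₁ r₂ (does⇒ (linked? (p₁ e) (p₂ e)) l))))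

      crosses-size : # crosses ≡ # (inside R) + # stray
      crosses-size = #-split pointwise
        where
        pointwise : ∀ e → ⟦ crosses e ⟧ ≡ ⟦ inside R e ⟧ + ⟦ crosses e ∧ not (inside R e) ⟧
        pointwise e with inside R e in r | crosses e in x
        ... | true  | true  = refl
        ... | true  | false = ⊥-elim (true≢false (R-edge-crosses e r) x)
        ... | false | true  = refl
        ... | false | false = refl

      module Cut (sep : Separated R 0) where

        open Separated sep

        -- Only the representative of a deleted class is cut; its remaining vertices have no way out
        -- and can only add components.
        cut : Vertex G → Bool
        cut v = (S v ∨ X v) ∨ (R v ∧ not (Z v))

        cut-size : # cut ≤ # S + # X + # (λ v → R v ∧ not (Z v))
        cut-size = ≤-trans (#-≤+ {f = cut} {g = λ v → S v ∨ X v} (λ v → ∨-≤+ (S v ∨ X v) (R v ∧ not (Z v))))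
                           (+-monoˡ-≤ _ (#-≤+ {f = λ v → S v ∨ X v} (λ v → ∨-≤+ (S v) (X v))))
          where
          ∨-≤+ : ∀ x y → ⟦ x ∨ y ⟧ ≤ ⟦ x ⟧ + ⟦ y ⟧
          ∨-≤+ true  y = s≤s z≤n
          ∨-≤+ false y = ≤-refl

        R-size : # R ≡ # Z + # (λ v → R v ∧ not (Z v))
        R-size = #-split pointwise
          where
          pointwise : ∀ v → ⟦ R v ⟧ ≡ ⟦ Z v ⟧ + ⟦ R v ∧ not (Z v) ⟧
          pointwise v with R v in r | Z v in z
          ... | true  | true  = refl
          ... | true  | false = refl
          ... | false | true  = ⊥-elim (true≢false (Z⊆A v z) r)
          ... | false | false = refl

        uncut : ∀ {v} → cut v ≡ false → S v ≡ false × X v ≡ false × (R v ≡ true → Z v ≡ true)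
        uncut {v} h with S v | X v | R v | Z v
        ... | false | false | false | _    = refl , refl , λ ()
        ... | false | false | true  | true = refl , refl , λ _ → refl

        y-uncut : ∀ i → cut (y i) ≡ false
        y-uncut i = table (R (y i)) (proj₁ (R⇒ y∈R)) (¬true⇒false λ x → true≢false y∈R (X∉R x)) (y∈Z i)
          where
          y∈R : R (y i) ≡ true
          y∈R = Z⊆A (y i) (y∈Z i)
          table : ∀ {s x z} r → s ≡ false → x ≡ false → z ≡ true → (s ∨ x) ∨ (r ∧ not z) ≡ false
          table r refl refl refl = ∧-zeroʳ r

        Uncut : Edge G → Set
        Uncut = Both (λ v → cut v ≡ false)

        -- An uncut walk changes class only along a crossing edge that is not stray, hence from
        -- representative to representative; steps inside a class project to nothing.
        project : ∀ {v w r r′} → Path Uncut v w → R r ≡ true → Z r ≡ true → Linked S v r → R r′ ≡ true → Linked S w r′ →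
                  Path (λ e → inside Z e ≡ true) r r′
        project done rr zr l rr′ l′ with refl ← R-unique rr rr′ (linked-trans (linked-sym l) l′) = done
        project {v} {r = r} (via {w = x} e (c₁ , c₂) j p) rr zr l rr′ l′ with linked? v x
        ... | yes vx = project p rr zr (linked-trans (linked-sym vx) l) rr′ l′
        ... | no ¬vx with inside R e in ins
        ...   | false = ⊥-elim (true≢false (X-strayEnd e is-stray) end-uncut)
          where
          not-joined : joined e ≡ false
          not-joined = dec-false (linked? (p₁ e) (p₂ e)) (λ l → ¬vx (orient j l))
            where
            orient : ∀ {v x} → Joins G e v x → Linked S (p₁ e) (p₂ e) → Linked S v x
            orient (inj₁ (refl , refl)) l = l
            orient (inj₂ (refl , refl)) l = linked-sym l
          is-stray : stray e ≡ true
          is-stray = true-∧ {crosses e} (true-∧ {inside outside e} (true-∧ (true-not (proj₁ (uncut c₁))) (true-not (proj₁ (uncut c₂))))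
                       (true-not not-joined)) (true-not ins)
          end-uncut : X (strayEnd e) ≡ false
          end-uncut = proj₁ (proj₂ (uncut (either (R (p₁ e)))))
            where
            either : ∀ t → cut (if t then p₂ e else p₁ e) ≡ false
            either true  = c₂
            either false = c₁
        ...   | true with inside-joins R j ins
        ...     | rv , rx with refl ← R-unique rv rr l =
          via e (joins-inside Z j zr zx) j (project p rx zx (linked-refl (proj₁ (R⇒ rx))) rr′ l′)
          where
          end : ∀ {x} → Joins G e v x → cut x ≡ false
          end (inj₁ (refl , refl)) = c₂
          end (inj₂ (refl , refl)) = c₁
          zx : Z x ≡ true
          zx = proj₂ (proj₂ (uncut (end j))) rx

        y-separated : ∀ i j → Path Uncut (y i) (y j) → i ≡ j
        y-separated i j p = separated i j (project p (Z⊆A _ (y∈Z i)) (y∈Z i) (self i) (Z⊆A _ (y∈Z j)) (self j))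
          where
          self : ∀ i → Linked S (y i) (y i)
          self i = linked-refl (proj₁ (R⇒ (Z⊆A _ (y∈Z i))))

        class-bound′ : # S + 5 + (# (inside R) + # stray) ≤ 2 * # R
        class-bound′ = ≤-trans (≤-reflexive (cong (# S + 5 +_) (sym crosses-size))) class-bound

        not-tough : ∀ c → k ≤ c → 7 * c ≤ 2 * # cut + 9 → ⊥
        not-tough c k≤c tough = 1+n≰n {9} (final-bound (# S) (# X) (# R) (# Z) (# (λ v → R v ∧ not (Z v)))
          (# (inside R)) (# stray) k c (# cut) bound class-bound′ R-size X-size cut-size k≤c tough)

-- Labelling the classes of a decidable equivalence

record Quotient {n} (P : Fin n → Set) (_~_ : Fin n → Fin n → Set) : Set where
  field
    size       : ℕ
    class      : Σ (Fin n) P → Fin size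
    surjective : Surjective _≡_ _≡_ class
    correct    : ∀ u v → (class u ≡ class v → proj₁ u ~ proj₁ v) × (proj₁ u ~ proj₁ v → class u ≡ class v)

-- Induction on `n`: vertex `zero` is left out, takes the label of a related later vertex, or opens
-- a new class.
quotient : ∀ {n} {P : Fin n → Set} {_~_ : Fin n → Fin n → Set} → IsEquivalence _~_ →
           (∀ v → Dec (P v)) → (∀ u v → Dec (u ~ v)) → Quotient P _~_
quotient {zero} eq P? ~? = record { size = 0 ; class = λ () ; surjective = λ () ; correct = λ () }
quotient {suc n} {P} {_~_} eq P? ~? with quotient {P = P ∘ suc} {_~_ = λ u v → suc u ~ suc v}
    (record { refl = IsEquivalence.refl eq ; sym = IsEquivalence.sym eq ; trans = IsEquivalence.trans eq })
    (P? ∘ suc) (λ u v → ~? (suc u) (suc v)) | P? zero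
... | q | no ¬p₀ = record { size = size ; class = class′ ; surjective = surj ; correct = corr }
  where
  open Quotient q
  class′ : Σ (Fin (suc n)) P → Fin size
  class′ (zero  , p) = ⊥-elim (¬p₀ p)
  class′ (suc v , p) = class (v , p)
  surj : Surjective _≡_ _≡_ class′
  surj i with surjective i
  ... | (v , p) , h = (suc v , p) , λ { refl → h refl }
  corr : ∀ u v → (class′ u ≡ class′ v → proj₁ u ~ proj₁ v) × (proj₁ u ~ proj₁ v → class′ u ≡ class′ v)
  corr (zero  , p) _           = ⊥-elim (¬p₀ p)
  corr (suc u , p) (zero  , r) = ⊥-elim (¬p₀ r)
  corr (suc u , p) (suc v , r) = correct (u , p) (v , r)
... | q | yes p₀ with any? (λ v → P? (suc v) ×-dec ~? zero (suc v))
...   | yes (w , pw , 0~w) = record { size = size ; class = class′ ; surjective = surj ; correct = corr }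
  where
  open Quotient q
  open IsEquivalence eq using () renaming (refl to ~-refl; sym to ~-sym; trans to ~-trans)
  class′ : Σ (Fin (suc n)) P → Fin size
  class′ (zero  , p) = class (w , pw)
  class′ (suc v , p) = class (v , p)
  surj : Surjective _≡_ _≡_ class′
  surj i with surjective i
  ... | (v , p) , h = (suc v , p) , λ { refl → h refl }
  corr : ∀ u v → (class′ u ≡ class′ v → proj₁ u ~ proj₁ v) × (proj₁ u ~ proj₁ v → class′ u ≡ class′ v)
  corr (zero  , p) (zero  , r) = (λ _ → ~-refl) , (λ _ → refl)
  corr (zero  , p) (suc v , r) = (λ h → ~-trans 0~w (proj₁ (correct (w , pw) (v , r)) h)) ,
                                 (λ h → proj₂ (correct (w , pw) (v , r)) (~-trans (~-sym 0~w) h))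
  corr (suc u , p) (zero  , r) = (λ h → ~-trans (proj₁ (correct (u , p) (w , pw)) h) (~-sym 0~w)) ,
                                 (λ h → proj₂ (correct (u , p) (w , pw)) (~-trans h 0~w))
  corr (suc u , p) (suc v , r) = correct (u , p) (v , r)
...   | no alone = record { size = suc size ; class = class′ ; surjective = surj ; correct = corr }
  where
  open Quotient q
  open IsEquivalence eq using () renaming (refl to ~-refl; sym to ~-sym; trans to ~-trans)
  class′ : Σ (Fin (suc n)) P → Fin (suc size)
  class′ (zero  , p) = zero
  class′ (suc v , p) = suc (class (v , p))
  surj : Surjective _≡_ _≡_ class′
  surj zero    = (zero , p₀) , λ { refl → refl }
  surj (suc i) with surjective i
  ... | (v , p) , h = (suc v , p) , λ { refl → cong suc (h refl) }
  corr : ∀ u v → (class′ u ≡ class′ v → proj₁ u ~ proj₁ v) × (proj₁ u ~ proj₁ v → class′ u ≡ class′ v)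
  corr (zero  , p) (zero  , r) = (λ _ → ~-refl) , (λ _ → refl)
  corr (zero  , p) (suc v , r) = (λ ()) , (λ h → ⊥-elim (alone (v , r , h)))
  corr (suc u , p) (zero  , r) = (λ ()) , (λ h → ⊥-elim (alone (u , p , ~-sym h)))
  corr (suc u , p) (suc v , r) = (λ h → proj₁ (correct (u , p) (v , r)) (suc-injective h)) ,
                                 (λ h → cong suc (proj₂ (correct (u , p) (v , r)) h))

-- From subsets and reachability to Boolean edge sets and walks

module Translation (G : Graph) where

  open Walks G
  open Swaps G
  open Barriers G

  -- Recursion on a list of allowed edges: a walk either avoids the head `f` or, after `split`,
  -- crosses it once, in one of two directions.
  path? : (P : Edge G → Set) → (∀ e → Dec (P e)) → ∀ x y → Dec (Path P x y)
  path? P P? x y = dec-map (weaken λ _ → proj₁) (weaken λ e p → p , ∈-allFin e) (search (allFin (m G)) x y)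
    where
    search : ∀ L x y → Dec (Path (λ e → P e × e ∈ₗ L) x y)
    search [] x y = dec-map (λ { refl → done }) (λ { done → refl ; (via _ (_ , ()) _ _) }) (x ≟ y)
    search (f ∷ L) x y with P? f
    ... | no ¬pf = dec-map (weaken λ _ (p , i) → p , there i) (weaken shrink) (search L x y)
      where
      shrink : ∀ e → P e × e ∈ₗ (f ∷ L) → P e × e ∈ₗ L
      shrink e (p , here refl) = ⊥-elim (¬pf p)
      shrink e (p , there i)   = p , i
    ... | yes pf = dec-map from to (search L x y ⊎-dec ((search L x (p₁ f) ×-dec search L (p₂ f) y) ⊎-dec
                                                       (search L x (p₂ f) ×-dec search L (p₁ f) y)))
      where
      Q : Edge G → Set
      Q e = P e × e ∈ₗ L
      grow : ∀ {x y} → Path Q x y → Path (λ e → P e × e ∈ₗ (f ∷ L)) x y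
      grow = weaken λ _ (p , i) → p , there i
      shrink : ∀ {x y} → Path (λ e → (P e × e ∈ₗ (f ∷ L)) × e ≢ f) x y → Path Q x y
      shrink = weaken λ { e ((p , here refl) , e≢f) → ⊥-elim (e≢f refl) ; e ((p , there i) , _) → p , i }
      from : Path Q x y ⊎ ((Path Q x (p₁ f) × Path Q (p₂ f) y) ⊎ (Path Q x (p₂ f) × Path Q (p₁ f) y)) →
             Path (λ e → P e × e ∈ₗ (f ∷ L)) x y
      from (inj₁ a)              = grow a
      from (inj₂ (inj₁ (a , b))) = grow a ⁀ via f (pf , here refl) (joins f) (grow b)
      from (inj₂ (inj₂ (a , b))) = grow a ⁀ via f (pf , here refl) (flip (joins f)) (grow b)
      to : Path (λ e → P e × e ∈ₗ (f ∷ L)) x y →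
           Path Q x y ⊎ ((Path Q x (p₁ f) × Path Q (p₂ f) y) ⊎ (Path Q x (p₂ f) × Path Q (p₁ f) y))
      to p with split f p
      ... | inj₁ a = inj₁ (shrink a)
      ... | inj₂ (_ , _ , _ , inj₁ (refl , refl) , a , b) = inj₂ (inj₁ (shrink a , shrink b))
      ... | inj₂ (_ , _ , _ , inj₂ (refl , refl) , a , b) = inj₂ (inj₂ (shrink a , shrink b))

  reach⇒path : ∀ {F u v} → Reach G F u v → Path (_∈ˢ F) u v
  reach⇒path here              = done
  reach⇒path (step e e∈F j r)  = via e e∈F j (reach⇒path r)

  path⇒reach : ∀ {F u v} → Path (_∈ˢ F) u v → Reach G F u v
  path⇒reach done             = here
  path⇒reach (via e e∈F j p)  = step e e∈F j (path⇒reach p)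

  reach? : ∀ F u v → Dec (Reach G F u v)
  reach? F u v = dec-map path⇒reach reach⇒path (path? (_∈ˢ F) (_∈? F) u v)

  reach-equivalence : ∀ F → IsEquivalence (Reach G F)
  reach-equivalence F = record
    { refl  = here
    ; sym   = λ r → path⇒reach (reverse (reach⇒path r))
    ; trans = λ r s → path⇒reach (reach⇒path r ⁀ reach⇒path s) }

  components : ∀ S → ∃ λ c → NumComponents G S c
  components S = size , class , surjective , correct
    where
    open Quotient (quotient {P = _∉ˢ S} (reach-equivalence (edgesAvoiding G S)) (λ v → ¬? (v ∈? S)) (reach? (edgesAvoiding G S)))

  ∈-tabulate : ∀ {k} {f : Fin k → Bool} {i} → i ∈ˢ tabulate f → f i ≡ true
  ∈-tabulate {f = f} {i} h = trans (sym (lookup∘tabulate f i)) ([]=⇒lookup h)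

  tabulate-∈ : ∀ {k} {f : Fin k → Bool} {i} → f i ≡ true → i ∈ˢ tabulate f
  tabulate-∈ {f = f} {i} h = lookup⇒[]= i (tabulate f) (trans (lookup∘tabulate f i) h)

  ∣tabulate∣ : ∀ {k} (f : Fin k → Bool) → ∣ tabulate f ∣ ≡ # f
  ∣tabulate∣ f = trans (∣∣≡# (tabulate f)) (#-cong (lookup∘tabulate f))

  degree-tabulate : ∀ F v → degree G (tabulate F) v ≡ # (λ e → F e ∧ inc v e)
  degree-tabulate F v = trans (∣∣≡# (tabulate F ∩ incident G v)) (#-cong λ e →
    trans (lookup-zipWith _∧_ e (tabulate F) (incident G v)) (cong₂ _∧_ (lookup∘tabulate F e)
      (trans (lookup∘tabulate _ e) (cong₂ _∨_ (isYes≗does (p₁ e ≟ v)) (isYes≗does (p₂ e ≟ v))))))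

  avoiding⇒ : ∀ {A : Vertex G → Bool} {e} → e ∈ˢ edgesAvoiding G (tabulate A) → Both (λ v → A v ≡ false) e
  avoiding⇒ {A} {e} h with p₁ e ∈? tabulate A | p₂ e ∈? tabulate A | ∈-tabulate h
  ... | no a | no b | _ = ¬true⇒false (a ∘ tabulate-∈) , ¬true⇒false (b ∘ tabulate-∈)

  merge : (F₁ F₂ : Edge G → Bool) → Colouring
  merge F₁ F₂ e = if F₁ e then just true else if F₂ e then just false else nothing

  initial-packing : TwoTreeConnected G → Vertex G → ∃ λ c → Packing c
  initial-packing (T₁ , T₂ , (conn₁ , _) , (conn₂ , _) , disjoint) r = merge F₁ F₂ , record { spans = spans ; size = size }
    where
    tree : EdgeSet G → Edge G → Bool
    tree T e = does (e ∈? T)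
    tree-spans : ∀ T → Connected G T → Spans (tree T)
    tree-spans T conn u v = weaken (λ e → dec-true (e ∈? T)) (reach⇒path (conn u v))
    pruned₁ = prune (tree T₁) (tree-spans T₁ conn₁) r
    pruned₂ = prune (tree T₂) (tree-spans T₂ conn₂) r
    F₁ F₂ : Edge G → Bool
    F₁ = proj₁ pruned₁
    F₂ = proj₁ pruned₂
    colour₁ : ∀ e → has true (merge F₁ F₂ e) ≡ F₁ e
    colour₁ e with F₁ e | F₂ e
    ... | true  | _     = refl
    ... | false | true  = refl
    ... | false | false = refl
    colour₂ : ∀ e → has false (merge F₁ F₂ e) ≡ F₂ e
    colour₂ e with F₁ e in f₁ | F₂ e in f₂
    ... | true  | true  = ⊥-elim (disjoint e (does⇒ (e ∈? T₁) (proj₁ (proj₂ pruned₁) e f₁)) (does⇒ (e ∈? T₂) (proj₁ (proj₂ pruned₂) e f₂)))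
    ... | true  | false = refl
    ... | false | true  = refl
    ... | false | false = refl
    spans : ∀ i → Spans (λ e → has i (merge F₁ F₂ e))
    spans true  u v = weaken (λ e → trans (colour₁ e)) (proj₁ (proj₂ (proj₂ pruned₁)) u v)
    spans false u v = weaken (λ e → trans (colour₂ e)) (proj₁ (proj₂ (proj₂ pruned₂)) u v)
    size : ∀ i → suc (# (λ e → has i (merge F₁ F₂ e))) ≡ n G
    size true  = trans (cong suc (#-cong colour₁)) (proj₂ (proj₂ (proj₂ pruned₁)))
    size false = trans (cong suc (#-cong colour₂)) (proj₂ (proj₂ (proj₂ pruned₂)))

Tough : Graph → Set
Tough G = ∀ (S : VertexSet G) (c : ℕ) → NumComponents G S c → 7 * c ≤ 2 * ∣ S ∣ + 9

Factor : Graph → Set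
Factor G = Σ (EdgeSet G) λ F → Is24Factor G F × Connected G F

-- Minimal total excess and the factor

module Conclusion (G : Graph) (2≤n : 2 ≤ n G) (tough : Tough G) where

  open Walks G
  open Swaps G
  open Barriers G
  open Parity G
  open Counting G
  open Translation G

  -- Decidability lets the refutation of the absence of a factor return an actual factor.
  factor? : Dec (Factor G)
  factor? = anySubset? λ F → all? (λ v → (degree G F v Nat.≟ 2) ⊎-dec (degree G F v Nat.≟ 4)) ×-dec
                             all? (λ u → all? (λ v → reach? F u v))

  light⇒factor : ∀ c → Packing c → (∀ v → deg c v ≤ 5) → Factor G
  light⇒factor c packing light with even-factor 2≤n c packing light
  ... | F , is24 , spans = tabulate F ,
    (λ v → subst (λ d → d ≡ 2 ⊎ d ≡ 4) (sym (degree-tabulate F v)) (is24 v)) ,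
    (λ u v → path⇒reach (weaken (λ _ → tabulate-∈) (spans u v)))

  no-barrier : ∀ b (packed : Packing b) (minimal : ∀ c → Packing c → total b ≤ total c) {u} →
               Minimal.Barrier b packed minimal u → 6 ≤ deg b u → ⊥
  no-barrier b packed minimal bar u-heavy = dne-all (λ v → decide-all (Minimal.Linked b packed minimal S v)) λ linked? →
      contradict linked?
    where
    open Minimal.Barrier bar using (S)
    contradict : (∀ v w → Dec (Minimal.Linked b packed minimal S v w)) → ⊥
    -- The separated vertices survive the cut and receive distinct component labels, so their number
    -- is at most `c`.
    contradict linked? = not-tough c (injective⇒≤ {f = λ i → class (y i , y∉cut i)} injective)
        (subst (λ k → 7 * c ≤ 2 * k + 9) (∣tabulate∣ cut) (tough (tabulate cut) c (class , rest)))
      where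
      open Cut b packed minimal bar u-heavy linked? (Separation.separable G (R b packed minimal bar u-heavy linked?))
      open Separation.Separated (Separation.separable G (R b packed minimal bar u-heavy linked?)) using (y)
      c = proj₁ (components (tabulate cut))
      class = proj₁ (proj₂ (components (tabulate cut)))
      rest = proj₂ (proj₂ (components (tabulate cut)))
      y∉cut : ∀ i → y i ∉ˢ tabulate cut
      y∉cut i h = true≢false (∈-tabulate h) (y-uncut i)
      injective : ∀ {i j} → class (y i , y∉cut i) ≡ class (y j , y∉cut j) → i ≡ j
      injective {i} {j} h = y-separated i j (weaken (λ _ → avoiding⇒)
        (reach⇒path (proj₁ (proj₂ rest (y i , y∉cut i) (y j , y∉cut j)) h)))

  -- A minimum is reached by well-founded descent on the total: excluded middle tells whether a
  -- better packing exists.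
  descend : ∀ c → Packing c → Acc _<_ (total c) → ¬ ¬ Factor G
  descend c packing (acc smaller) none = em {P = ∃ λ c′ → Packing c′ × total c′ < total c} λ
    { (yes (c′ , packing′ , lt)) → descend c′ packing′ (smaller lt) none
    ; (no best) → at-minimum (λ c′ packing′ → ≮⇒≥ (λ lt → best (c′ , packing′ , lt))) }
    where
    at-minimum : (∀ c′ → Packing c′ → total c ≤ total c′) → ⊥
    at-minimum minimal with any? (λ v → 6 ≤? deg c v)
    ... | yes (u , heavy) = Minimal.barrier c packing minimal u heavy (λ bar → no-barrier c packing minimal bar heavy)
    ... | no light = none (light⇒factor c packing (λ v → ≤-pred (≰⇒> (λ h → light (v , h)))))

  factor : TwoTreeConnected G → Factor G
  factor trees = decidable-stable factor? λ none →
      descend (proj₁ start) (proj₂ start) (<-wellFounded _) none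
    where
    start : ∃ λ c → Packing c
    start = initial-packing trees (subst Fin (m+[n∸m]≡n 2≤n) zero)

theorem9p5 : (G : Graph) → 2 ≤ n G → TwoTreeConnected G →
    (∀ (S : VertexSet G) (c : ℕ) → NumComponents G S c → 7 * c ≤ 2 * ∣ S ∣ + 9) →
    Σ (EdgeSet G) λ F → Is24Factor G F × Connected G F
theorem9p5 G 2≤n trees tough = Conclusion.factor G 2≤n tough trees
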